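{- Let $H$ be a fixed graph with chromatic number $\chi(H)=3$, and let $g\ge 2$ be the smallest integer such that there is no graph homomorphism $H\to C_{2g+1}$. For every $\varepsilon>0$, there exist constants $C>0$, $\rho>0$ and $n_0$ (depending only on $H$ and $\varepsilon$) such that every $H$-free graph $G$ on $n\ge n_0$ vertices with $$\delta(G)\ge\left(\frac{2}{2g+1}+\varepsilon\right)n$$ satisfies $\gamma_2(G)\le C n^{2-\rho}$.
   Context: All graphs are finite and simple. $\delta(G)$ is the minimum degree of $G$, and $C_\ell$ is the cycle of length $\ell$. A graph $G$ is $H$-free if it contains no (not necessarily induced) subgraph isomorphic to $H$. For a graph $G$ and $X\subseteq V(G)$, $G[X]$ is the induced subgraph on $X$ and $e(\cdot)$ counts edges; define $$\gamma_2(G)=\min_{V(G)=X\cup Y}\bigl(e(G[X])+e(G[Y])\bigr),$$ the minimum being over partitions of $V(G)$ into two (possibly empty) parts $X,Y$; equivalently, $\gamma_2(G)$ is the minimum number of edges that must be deleted from $G$ to make it bipartite. -}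

module Defs where

open import Data.Fin using (Fin; toℕ; _<?_)
import Data.Fin.Properties as Fin
open import Data.Fin.Subset using (Subset; inside; outside; ⊤; ∁)
open import Data.Fin.Subset.Properties using (_∈?_)
open import Data.Integer as ℤ using (+_)
open import Data.List using (List; []; _∷_; _++_; map; filter; length; lookup; allFin; cartesianProduct)
open import Data.List.Extrema.Nat using (min)
open import Data.Nat using (ℕ; zero; suc; _+_; _*_; _≤_; _≟_)
open import Data.Product using (_×_; _,_; ∃; uncurry)
open import Data.Rational as ℚ using (ℚ; ↥_; ↧ₙ_)
open import Data.Rational.Literals using (fromℤ)
open import Data.Sum using (_⊎_; swap)
open import Data.Vec using ([]; _∷_)
open import Function using (_∘_)
open import Function.Definitions using (Injective)
open import Level using (0ℓ)
open import Relation.Binary using (Rel; Symmetric; Irreflexive; Decidable; _=[_]⇒_)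
open import Relation.Binary.PropositionalEquality using (_≡_; _≢_; sym; cong)
open import Relation.Nullary using (¬_; ¬?)
open import Relation.Nullary.Decidable using (_×-dec_; _⊎-dec_)
import Algebra.Definitions.RawSemiring as RawSemiring
open RawSemiring ℚ.+-*-rawSemiring using () renaming (_^_ to _^ℚ_)

record Graph (n : ℕ) : Set₁ where
  infix 4 _~_ _~?_
  field
    _~_    : Rel (Fin n) 0ℓ
    _~?_   : Decidable _~_
    ~-sym  : Symmetric _~_
    ~-irrefl : Irreflexive _≡_ _~_

open Graph public using (~-sym; ~-irrefl)

module _ {n} (G : Graph n) where
  open Graph G

  degree : Fin n → ℕ
  degree v = length (filter (v ~?_) (allFin n))

  -- Degrees are below n, so the default value n of `min` is only attained when
  -- n = 0; the graph without vertices gets minimum degree 0.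
  δ : ℕ
  δ = min n (map degree (allFin n))

  -- Each edge is listed once, with its smaller endpoint first.
  edges : List (Fin n × Fin n)
  edges = filter (uncurry λ u v → (u <? v) ×-dec (u ~? v))
                 (cartesianProduct (allFin n) (allFin n))

  e : ℕ
  e = length edges

elements : ∀ {n} → Subset n → List (Fin n)
elements {n} X = filter (_∈? X) (allFin n)

-- The i-th vertex of G [ X ] is the i-th element of X in increasing order.
_[_] : ∀ {n} → Graph n → (X : Subset n) → Graph (length (elements X))
_[_] {n} G X = record
  { _~_      = λ i j → vertex i ~ vertex j
  ; _~?_     = λ i j → vertex i ~? vertex j
  ; ~-sym    = ~-sym G
  ; ~-irrefl = λ i≡j → ~-irrefl G (cong vertex i≡j)
  }
  where
  open Graph G using (_~_; _~?_)
  vertex : Fin (length (elements X)) → Fin n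
  vertex = lookup (elements X)

subsets : ∀ n → List (Subset n)
subsets zero    = [] ∷ []
subsets (suc n) = map (outside ∷_) (subsets n) ++ map (inside ∷_) (subsets n)

-- The default value of `min` is the cost of the partition (V(G), ∅), which also
-- occurs in the list.
γ₂ : ∀ {n} → Graph n → ℕ
γ₂ {n} G = min (cost ⊤) (map cost (subsets n))
  where
  cost : Subset n → ℕ
  cost X = e (G [ X ]) + e (G [ ∁ X ])

infix 4 _⟶_ _-free_

IsHom : ∀ {m n} → Graph m → Graph n → (Fin m → Fin n) → Set
IsHom G H f = Graph._~_ G =[ f ]⇒ Graph._~_ H

_⟶_ : ∀ {m n} → Graph m → Graph n → Set
G ⟶ H = ∃ λ f → IsHom G H f

-- A copy of H as a not necessarily induced subgraph of G is the image of an
-- injective homomorphism.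
_-free_ : ∀ {m n} → Graph m → Graph n → Set
H -free G = ¬ ∃ λ f → Injective _≡_ _≡_ f × IsHom H G f

Colourable : ∀ {n} → Graph n → ℕ → Set
Colourable {n} G k = ∃ λ (c : Fin n → Fin k) → ∀ {u v} → Graph._~_ G u v → c u ≢ c v

IsLeast : (ℕ → Set) → ℕ → Set
IsLeast P k = P k × (∀ j → P j → k ≤ j)

HasChromaticNumber : ∀ {n} → Graph n → ℕ → Set
HasChromaticNumber G = IsLeast (Colourable G)

-- The condition i ≢ j only matters for ℓ = 1, where it excludes the loop; for
-- ℓ ≥ 3 this is the cycle of length ℓ.
Cycle : (ℓ : ℕ) → Graph ℓ
Cycle ℓ = record
  { _~_      = λ i j → i ≢ j × (Next i j ⊎ Next j i)
  ; _~?_     = λ i j → ¬? (i Fin.≟ j) ×-dec (next? i j ⊎-dec next? j i)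
  ; ~-sym    = λ (i≢j , adj) → i≢j ∘ sym , swap adj
  ; ~-irrefl = λ i≡j (i≢j , _) → i≢j i≡j
  }
  where
  Next : Rel (Fin ℓ) 0ℓ
  Next i j = suc (toℕ i) ≡ toℕ j ⊎ (suc (toℕ i) ≡ ℓ × toℕ j ≡ 0)

  next? : Decidable Next
  next? i j = (suc (toℕ i) ≟ toℕ j) ⊎-dec ((suc (toℕ i) ≟ ℓ) ×-dec (toℕ j ≟ 0))

fromℕ : ℕ → ℚ
fromℕ n = fromℤ (+ n)

-- x ≤ C·n^(2−ρ) for C, ρ > 0 and n ≥ 1: writing ρ = p/q in lowest terms, raise both
-- sides to the power q and multiply by n^p, giving x^q · n^p ≤ C^q · n^(2q).
infix 4 _≤_·_^2-_
_≤_·_^2-_ : ℕ → ℚ → ℕ → ℚ → Set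
x ≤ C · n ^2- ρ = fromℕ x ^ℚ q ℚ.* fromℕ n ^ℚ p ℚ.≤ C ^ℚ q ℚ.* fromℕ n ^ℚ (2 * q)
  where
  p q : ℕ
  p = ℤ.∣ ↥ ρ ∣
  q = ↧ₙ ρ

{-# OPTIONS --safe #-}
-- Call a property of b-tuples of vertices robust if a fraction 1/D of all tuples has it, where
-- D is a small power of n. By Hölder's inequality a robust property holds on a full blow-up
-- with h distinct vertices per coordinate. Minimality of g gives a homomorphism from H to the
-- cycle of length 2g − 1, so in an H-free graph no robust property can force a closed walk of
-- length 2g − 1. Nor can it force a longer odd closed walk: by the degree condition linearly
-- many vertices have three neighbours on a closed walk of length at least 2g + 1, and each of
-- them shortcuts it to a shorter odd one.
--
-- Now choose centres greedily, vertices with pairwise small codegree. Since degrees are linear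
-- the process stops after boundedly many steps, so robustly many tuples of centres have large
-- codegree with all but n/D vertices. Join two centres if at least n²/D edges run between their
-- classes. If this bounded graph has an odd cycle, replacing each of its edges by robustly many
-- walks of length five between the centres gives a robust odd closed walk, which is impossible.
-- Otherwise a two-colouring of the centres colours G with O(n²/D) monochromatic edges.
module Submission where

open import Defs
open import Data.Bool using (Bool; true; false; if_then_else_; not; _xor_)
import Data.Bool.Properties as Bool
open import Data.Fin as Fin using (Fin; zero; suc; toℕ)
import Data.Fin.Properties as Fin
open import Data.Fin.Subset using (Subset; inside; outside; ∁) renaming (_∈_ to _∈ˢ_)
open import Data.Fin.Subset.Properties using (_∈?_; x∈∁p⇒x∉p)
import Data.Integer.Properties as ℤ
open import Data.List as List
  using (List; []; _∷_; _++_; map; filter; length; allFin; cartesianProduct; cartesianProductWith)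
open import Data.List.Extrema.Nat using (min≤v⁺)
open import Data.List.Membership.Propositional using (_∈_)
open import Data.List.Membership.Propositional.Properties
  using (∈-allFin; ∈-cartesianProduct⁺; ∈-cartesianProductWith⁺; ∈-map⁺; ∈-++⁺ˡ; ∈-++⁺ʳ)
open import Data.List.Properties using (length-tabulate; tabulate-lookup)
open import Data.List.Relation.Unary.Any as Any using (here; there)
open import Data.Nat hiding (_/_)
open import Data.Nat.Coprimality using (1-coprimeTo)
open import Data.Nat.Properties
open import Data.Nat.Tactic.RingSolver using (solve-∀)
open import Data.Product using (_×_; _,_; ∃; proj₁; proj₂; uncurry)
open import Data.Rational as ℚ using (ℚ; 0ℚ; 1ℚ; mkℚ; ↧ₙ_; _/_)
import Data.Rational.Properties as ℚ
import Data.Rational.Solver as ℚ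
import Data.Rational.Unnormalised as ℚᵘ
import Data.Rational.Unnormalised.Properties as ℚᵘ
open import Data.Sum using (_⊎_; inj₁; inj₂)
open import Data.Unit using (⊤; tt)
open import Data.Vec using (Vec; []; _∷_; lookup; tabulate; concat) renaming (_++_ to _++ᵥ_)
import Data.Vec.Properties as Vec
open import Data.Vec.Properties using (lookup-concat; lookup∘tabulate; []=⇒lookup; lookup⇒[]=)
open import Function using (id; _∘_; const)
open import Function.Definitions using (Injective)
open import Level using (0ℓ)
import Relation.Binary as Binary
open import Relation.Binary using (Rel; Symmetric)
open import Relation.Binary.PropositionalEquality hiding ([_]; J)
open import Relation.Nullary using (Dec; yes; no; ¬_; ¬?; does; contradiction)
open import Relation.Nullary.Decidable
  using (_×-dec_; _⊎-dec_; _→-dec_; map′; dec-true; dec-false; from-yes)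
open import Relation.Unary using (Decidable)
import Algebra.Definitions.RawSemiring as RawSemiring
open RawSemiring ℚ.+-*-rawSemiring using () renaming (_^_ to _^ℚ_)

-- The quantitative difficulty is that every loss must be polynomial in D, with an exponent that
-- depends only on H and ε. A blow-up raises the density of a pattern with b coordinates to the
-- power h^b, so b has to be fixed before D is chosen. For this reason the codegree threshold for
-- centres is a constant fraction of n, and only the exceptional vertices and the sparse pairs are
-- measured with D. This bounds the number of centres, hence the length of the odd closed walks
-- between them, hence the number of rounds of shortening, all independently of D. The total loss is
-- a constant times a fixed power of D, and D can be the integer part of a fixed root of n.
--
-- A single odd closed walk in G could not be blown up. Walks therefore run through the coordinates
-- of a pattern, and their steps are adjacencies valid in every tuple. Whatever varies with the
-- tuple, such as which pairs of centres are dense or which arc gets shortened, is fixed by the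
-- pigeonhole principle at the price of a constant factor.

private variable
  A B C : Set

-- Sums over lists

∑ : List A → (A → ℕ) → ℕ
∑ []       f = 0
∑ (x ∷ xs) f = f x + ∑ xs f

∑-mono : ∀ (xs : List A) {f g : A → ℕ} → (∀ x → f x ≤ g x) → ∑ xs f ≤ ∑ xs g
∑-mono []       f≤g = z≤n
∑-mono (x ∷ xs) f≤g = +-mono-≤ (f≤g x) (∑-mono xs f≤g)

∑-cong : ∀ (xs : List A) {f g : A → ℕ} → (∀ x → f x ≡ g x) → ∑ xs f ≡ ∑ xs g
∑-cong []       f≡g = refl
∑-cong (x ∷ xs) f≡g = cong₂ _+_ (f≡g x) (∑-cong xs f≡g)

+-interchange : ∀ a b c d → (a + b) + (c + d) ≡ (a + c) + (b + d)
+-interchange = solve-∀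

∑-+ : ∀ (xs : List A) (f g : A → ℕ) → ∑ xs (λ x → f x + g x) ≡ ∑ xs f + ∑ xs g
∑-+ []       f g = refl
∑-+ (x ∷ xs) f g =
  trans (cong (f x + g x +_) (∑-+ xs f g)) (+-interchange (f x) (g x) (∑ xs f) (∑ xs g))

∑-*ˡ : ∀ k (xs : List A) (f : A → ℕ) → ∑ xs (λ x → k * f x) ≡ k * ∑ xs f
∑-*ˡ k []       f = sym (*-zeroʳ k)
∑-*ˡ k (x ∷ xs) f = trans (cong (k * f x +_) (∑-*ˡ k xs f)) (sym (*-distribˡ-+ k (f x) (∑ xs f)))

∑-*ʳ : ∀ k (xs : List A) (f : A → ℕ) → ∑ xs (λ x → f x * k) ≡ ∑ xs f * k
∑-*ʳ k xs f = trans (∑-cong xs λ x → *-comm (f x) k) (trans (∑-*ˡ k xs f) (*-comm k (∑ xs f)))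

∑-const : ∀ (xs : List A) k → ∑ xs (λ _ → k) ≡ length xs * k
∑-const []       k = refl
∑-const (x ∷ xs) k = cong (k +_) (∑-const xs k)

∑-swap : ∀ (xs : List A) (ys : List B) (f : A → B → ℕ) →
         ∑ xs (λ x → ∑ ys (f x)) ≡ ∑ ys (λ y → ∑ xs (λ x → f x y))
∑-swap []       ys f = sym (trans (∑-const ys 0) (*-zeroʳ (length ys)))
∑-swap (x ∷ xs) ys f =
  trans (cong (∑ ys (f x) +_) (∑-swap xs ys f)) (sym (∑-+ ys (f x) _))

∑-++ : ∀ (xs ys : List A) (f : A → ℕ) → ∑ (xs ++ ys) f ≡ ∑ xs f + ∑ ys f
∑-++ []       ys f = refl
∑-++ (x ∷ xs) ys f = trans (cong (f x +_) (∑-++ xs ys f)) (sym (+-assoc (f x) _ _))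

∑-map : ∀ (h : A → B) (xs : List A) (f : B → ℕ) → ∑ (map h xs) f ≡ ∑ xs (f ∘ h)
∑-map h []       f = refl
∑-map h (x ∷ xs) f = cong (f (h x) +_) (∑-map h xs f)

∑-product : ∀ (h : A → B → C) xs ys (f : C → ℕ) →
            ∑ (cartesianProductWith h xs ys) f ≡ ∑ xs (λ x → ∑ ys (λ y → f (h x y)))
∑-product h []       ys f = refl
∑-product h (x ∷ xs) ys f =
  trans (∑-++ (map (h x) ys) _ f) (cong₂ _+_ (∑-map (h x) ys f) (∑-product h xs ys f))

∑-<⇒∃ : ∀ (xs : List A) (f g : A → ℕ) → ∑ xs f < ∑ xs g → ∃ λ x → f x < g x
∑-<⇒∃ (x ∷ xs) f g lt with f x <? g x
... | yes fx<gx = x , fx<gx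
... | no  fx≮gx = ∑-<⇒∃ xs f g
      (+-cancelˡ-< (g x) _ _ (≤-<-trans (+-monoˡ-≤ (∑ xs f) (≮⇒≥ fx≮gx)) lt))



∑-average : ∀ x (xs : List A) (f : A → ℕ) → ∃ λ y → ∑ (x ∷ xs) f ≤ suc (length xs) * f y
∑-average x []        f = x , ≤-refl
∑-average x (x′ ∷ xs) f with ∑-average x′ xs f
... | y , ∑≤ with ≤-total (f x) (f y)
...   | inj₁ fx≤fy = y , +-mono-≤ fx≤fy ∑≤
...   | inj₂ fy≤fx = x , +-monoʳ-≤ (f x) (≤-trans ∑≤ (*-monoʳ-≤ (suc (length xs)) fy≤fx))

rearrangement : ∀ {a b p q} → a ≤ b → p ≤ q → a * q + b * p ≤ a * p + b * q
rearrangement {a} {b} {p} {q} a≤b p≤q with m≤n⇒∃[o]m+o≡n a≤b | m≤n⇒∃[o]m+o≡n p≤q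
... | d , refl | e , refl = ≤-trans (m≤m+n _ (d * e)) (≤-reflexive (identity a d p e))
  where
  identity : ∀ a d p e → a * (p + e) + (a + d) * p + d * e ≡ a * p + (a + d) * (p + e)
  identity = solve-∀

-- The values of `f` and of its powers are ordered alike, so `rearrangement` applies to every two
-- entries of the list. The induction compares the new entry with each of the others.
chebyshev : ∀ (xs : List A) (f : A → ℕ) k →
            ∑ xs f * ∑ xs (λ x → f x ^ k) ≤ length xs * ∑ xs (λ x → f x ^ suc k)
chebyshev []       f k = z≤n
chebyshev (x ∷ xs) f k = begin
  (a + S) * (p + T)                        ≡⟨ expand a S p T ⟩
  a * p + (a * T + p * S) + S * T          ≤⟨ +-mono-≤ (+-monoʳ-≤ (a * p) cross) (chebyshev xs f k) ⟩
  a * p + (length xs * (a * p) + U) + length xs * U ≡⟨ collect (a * p) (length xs) U ⟩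
  suc (length xs) * (a * p + U)            ∎
  where
  open ≤-Reasoning
  a = f x
  p = f x ^ k
  S = ∑ xs f
  T = ∑ xs (λ y → f y ^ k)
  U = ∑ xs (λ y → f y ^ suc k)
  expand : ∀ a S p T → (a + S) * (p + T) ≡ a * p + (a * T + p * S) + S * T
  expand = solve-∀
  collect : ∀ c l U → c + (l * c + U) + l * U ≡ suc l * (c + U)
  collect = solve-∀
  pointwise : ∀ y → a * f y ^ k + p * f y ≤ a * p + f y ^ suc k
  pointwise y with ≤-total a (f y)
  ... | inj₁ a≤ = subst (λ z → a * f y ^ k + z ≤ a * p + f y ^ suc k) (*-comm (f y) p) (rearrangement a≤ (^-monoˡ-≤ k a≤))
  ... | inj₂ ≤a = subst₂ _≤_
        (trans (+-comm (f y * p) _) (cong (a * f y ^ k +_) (*-comm (f y) p)))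
        (+-comm (f y * f y ^ k) (a * p))
        (rearrangement ≤a (^-monoˡ-≤ k ≤a))
  cross : a * T + p * S ≤ length xs * (a * p) + U
  cross = begin
    a * T + p * S
      ≡⟨ cong₂ _+_ (∑-*ˡ a xs _) (∑-*ˡ p xs f) ⟨
    ∑ xs (λ y → a * f y ^ k) + ∑ xs (λ y → p * f y)
      ≡⟨ ∑-+ xs _ _ ⟨
    ∑ xs (λ y → a * f y ^ k + p * f y)
      ≤⟨ ∑-mono xs pointwise ⟩
    ∑ xs (λ y → a * p + f y ^ suc k)
      ≡⟨ ∑-+ xs _ _ ⟩
    ∑ xs (λ _ → a * p) + U
      ≡⟨ cong (_+ U) (∑-const xs (a * p)) ⟩
    length xs * (a * p) + U ∎

-- The usual exponent k - 1 of the length is avoided by multiplying the left side by the length,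
-- which also admits k = 0.
power-mean : ∀ (xs : List A) (f : A → ℕ) k →
             ∑ xs f ^ k * length xs ≤ length xs ^ k * ∑ xs (λ x → f x ^ k)
power-mean xs f zero    = ≤-reflexive (cong (_+ 0)
  (sym (trans (∑-const xs 1) (*-identityʳ (length xs)))))
power-mean xs f (suc k) = begin
  S * S ^ k * l            ≡⟨ *-assoc S (S ^ k) l ⟩
  S * (S ^ k * l)          ≤⟨ *-monoʳ-≤ S (power-mean xs f k) ⟩
  S * (l ^ k * T)          ≡⟨ rotate S (l ^ k) T ⟩
  l ^ k * (S * T)          ≤⟨ *-monoʳ-≤ (l ^ k) (chebyshev xs f k) ⟩
  l ^ k * (l * U)          ≡⟨ rotate′ (l ^ k) l U ⟩
  l * l ^ k * U            ∎
  where
  open ≤-Reasoning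
  l = length xs
  S = ∑ xs f
  T = ∑ xs (λ y → f y ^ k)
  U = ∑ xs (λ y → f y ^ suc k)
  rotate : ∀ a b c → a * (b * c) ≡ b * (a * c)
  rotate = solve-∀
  rotate′ : ∀ a b c → a * (b * c) ≡ b * a * c
  rotate′ = solve-∀

-- Indicators and counting

⟦_⟧ : ∀ {P : Set} → Dec P → ℕ
⟦ P? ⟧ = if does P? then 1 else 0

⟦⟧≤1 : ∀ {P : Set} (P? : Dec P) → ⟦ P? ⟧ ≤ 1
⟦⟧≤1 (yes _) = s≤s z≤n
⟦⟧≤1 (no  _) = z≤n

⟦⟧-true : ∀ {P : Set} (P? : Dec P) → P → ⟦ P? ⟧ ≡ 1
⟦⟧-true (yes _) p = refl
⟦⟧-true (no ¬p) p = contradiction p ¬p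

⟦⟧-positive : ∀ {P : Set} (P? : Dec P) → 0 < ⟦ P? ⟧ → P
⟦⟧-positive (yes p) _ = p

⟦⟧-≤ : ∀ {P : Set} (P? : Dec P) {k} → (P → 1 ≤ k) → ⟦ P? ⟧ ≤ k
⟦⟧-≤ (yes p) 1≤k = 1≤k p
⟦⟧-≤ (no  _) 1≤k = z≤n

⟦⟧-mono : ∀ {P Q : Set} (P? : Dec P) (Q? : Dec Q) → (P → Q) → ⟦ P? ⟧ ≤ ⟦ Q? ⟧
⟦⟧-mono P? Q? P→Q = ⟦⟧-≤ P? λ p → ≤-reflexive (sym (⟦⟧-true Q? (P→Q p)))

⟦⟧-cong : ∀ {P Q : Set} (P? : Dec P) (Q? : Dec Q) → (P → Q) → (Q → P) → ⟦ P? ⟧ ≡ ⟦ Q? ⟧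
⟦⟧-cong P? Q? P→Q Q→P = ≤-antisym (⟦⟧-mono P? Q? P→Q) (⟦⟧-mono Q? P? Q→P)

⟦⟧-× : ∀ {P Q : Set} (P? : Dec P) (Q? : Dec Q) → ⟦ P? ×-dec Q? ⟧ ≡ ⟦ P? ⟧ * ⟦ Q? ⟧
⟦⟧-× (yes _) (yes _) = refl
⟦⟧-× (yes _) (no  _) = refl
⟦⟧-× (no  _) _       = refl

count : ∀ {P : A → Set} → Decidable P → List A → ℕ
count P? xs = ∑ xs (λ x → ⟦ P? x ⟧)

∑-filter : ∀ {P : A → Set} (P? : Decidable P) xs (f : A → ℕ) →
           ∑ (filter P? xs) f ≡ ∑ xs (λ x → ⟦ P? x ⟧ * f x)
∑-filter P? []       f = refl
∑-filter P? (x ∷ xs) f with P? x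
... | yes _ = cong₂ _+_ (sym (+-identityʳ (f x))) (∑-filter P? xs f)
... | no  _ = ∑-filter P? xs f

length-filter≡count : ∀ {P : A → Set} (P? : Decidable P) xs → length (filter P? xs) ≡ count P? xs
length-filter≡count P? []       = refl
length-filter≡count P? (x ∷ xs) with P? x
... | yes _ = cong suc (length-filter≡count P? xs)
... | no  _ = length-filter≡count P? xs

-- Vectors with entries in a list

vecs : List A → (k : ℕ) → List (Vec A k)
vecs xs zero    = [] ∷ []
vecs xs (suc k) = cartesianProductWith _∷_ xs (vecs xs k)

∑-vecs : ∀ (xs : List A) k (f : Vec A (suc k) → ℕ) →
         ∑ (vecs xs (suc k)) f ≡ ∑ xs (λ x → ∑ (vecs xs k) (λ v → f (x ∷ v)))
∑-vecs xs k f = ∑-product _∷_ xs (vecs xs k) f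

length≡∑1 : ∀ (xs : List A) → length xs ≡ ∑ xs (λ _ → 1)
length≡∑1 xs = sym (trans (∑-const xs 1) (*-identityʳ _))

length-vecs : ∀ (xs : List A) k → length (vecs xs k) ≡ length xs ^ k
length-vecs xs zero    = refl
length-vecs xs (suc k) = begin
  length (vecs xs (suc k))                     ≡⟨ length≡∑1 (vecs xs (suc k)) ⟩
  ∑ (vecs xs (suc k)) (λ _ → 1)                ≡⟨ ∑-vecs xs k _ ⟩
  ∑ xs (λ _ → ∑ (vecs xs k) (λ _ → 1))         ≡⟨ ∑-const xs _ ⟩
  length xs * ∑ (vecs xs k) (λ _ → 1)          ≡⟨ cong (length xs *_) (length≡∑1 (vecs xs k)) ⟨
  length xs * length (vecs xs k)               ≡⟨ cong (length xs *_) (length-vecs xs k) ⟩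
  length xs * length xs ^ k                    ∎
  where open ≡-Reasoning

∑-vecs-++ : ∀ (xs : List A) k l (f : Vec A (k + l) → ℕ) →
            ∑ (vecs xs (k + l)) f ≡ ∑ (vecs xs k) (λ v → ∑ (vecs xs l) (λ w → f (v ++ᵥ w)))
∑-vecs-++ xs zero    l f = sym (+-identityʳ _)
∑-vecs-++ xs (suc k) l f = begin
  ∑ (vecs xs (suc k + l)) f
    ≡⟨ ∑-vecs xs (k + l) f ⟩
  ∑ xs (λ x → ∑ (vecs xs (k + l)) (λ v → f (x ∷ v)))
    ≡⟨ ∑-cong xs (λ x → ∑-vecs-++ xs k l (λ v → f (x ∷ v))) ⟩
  ∑ xs (λ x → ∑ (vecs xs k) (λ v → ∑ (vecs xs l) (λ w → f (x ∷ v ++ᵥ w))))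
    ≡⟨ ∑-vecs xs k _ ⟨
  ∑ (vecs xs (suc k)) (λ v → ∑ (vecs xs l) (λ w → f (v ++ᵥ w))) ∎
  where open ≡-Reasoning

-- Blow-ups of a robust pattern

^-distribʳ-* : ∀ m n k → (m * n) ^ k ≡ m ^ k * n ^ k
^-distribʳ-* m n zero    = refl
^-distribʳ-* m n (suc k) = trans (cong (m * n *_) (^-distribʳ-* m n k)) (swap-middle m n (m ^ k) (n ^ k))
  where
  swap-middle : ∀ a b c d → a * b * (c * d) ≡ a * c * (b * d)
  swap-middle = solve-∀

∏ : ∀ {h} → Vec A h → (A → ℕ) → ℕ
∏ []       f = 1
∏ (x ∷ xs) f = f x * ∏ xs f

∑-∏ : ∀ (xs : List A) h (f : A → ℕ) → ∑ (vecs xs h) (λ v → ∏ v f) ≡ ∑ xs f ^ h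
∑-∏ xs zero    f = refl
∑-∏ xs (suc h) f = begin
  ∑ (vecs xs (suc h)) (λ v → ∏ v f)                ≡⟨ ∑-vecs xs h _ ⟩
  ∑ xs (λ x → ∑ (vecs xs h) (λ v → f x * ∏ v f))   ≡⟨ ∑-cong xs (λ x → ∑-*ˡ (f x) (vecs xs h) _) ⟩
  ∑ xs (λ x → f x * ∑ (vecs xs h) (λ v → ∏ v f))   ≡⟨ ∑-*ʳ _ xs f ⟩
  ∑ xs f * ∑ (vecs xs h) (λ v → ∏ v f)             ≡⟨ cong (∑ xs f *_) (∑-∏ xs h f) ⟩
  ∑ xs f * ∑ xs f ^ h                              ∎
  where open ≡-Reasoning

select : ∀ {b h} → Vec (Vec A h) b → (Fin b → Fin h) → Vec A b
select []      φ = []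
select (Y ∷ X) φ = lookup Y (φ zero) ∷ select X (φ ∘ suc)

lookup-select : ∀ {b h} (X : Vec (Vec A h) b) φ i → lookup (select X φ) i ≡ lookup (lookup X i) (φ i)
lookup-select (Y ∷ X) φ zero    = refl
lookup-select (Y ∷ X) φ (suc i) = lookup-select X (φ ∘ suc) i

-- Expanded, this is the product of `F` over all selections of one entry per class. The nesting lets
-- one coordinate be split off at a time.
blowUp : ∀ {b h} → (Vec A b → ℕ) → Vec (Vec A h) b → ℕ
blowUp F []      = F []
blowUp F (Y ∷ X) = ∏ Y (λ y → blowUp (F ∘ (y ∷_)) X)

∏-≤1 : ∀ {h} (Y : Vec A h) {f : A → ℕ} → (∀ y → f y ≤ 1) → ∏ Y f ≤ 1
∏-≤1 []      f≤1 = ≤-refl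
∏-≤1 (y ∷ Y) f≤1 = *-mono-≤ (f≤1 y) (∏-≤1 Y f≤1)

∏-positive : ∀ {h} (Y : Vec A h) {f : A → ℕ} → 0 < ∏ Y f → ∀ i → 0 < f (lookup Y i)
∏-positive (y ∷ Y) {f} 0<∏ i with f y in eq
∏-positive (y ∷ Y) {f} 0<∏ zero    | suc k = subst (0 <_) (sym eq) z<s
∏-positive (y ∷ Y) {f} 0<∏ (suc i) | suc k with ∏ Y f in eq′
... | zero  = contradiction (subst (0 <_) (*-zeroʳ k) 0<∏) λ ()
... | suc _ = ∏-positive Y (subst (0 <_) (sym eq′) z<s) i

blowUp-≤1 : ∀ {b h} (F : Vec A b → ℕ) (X : Vec (Vec A h) b) → (∀ v → F v ≤ 1) → blowUp F X ≤ 1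
blowUp-≤1 F []      F≤1 = F≤1 []
blowUp-≤1 F (Y ∷ X) F≤1 = ∏-≤1 Y λ y → blowUp-≤1 (F ∘ (y ∷_)) X (F≤1 ∘ (y ∷_))

blowUp-positive : ∀ {b h} (F : Vec A b → ℕ) (X : Vec (Vec A h) b) →
                  0 < blowUp F X → ∀ φ → 0 < F (select X φ)
blowUp-positive F []      0<F φ = 0<F
blowUp-positive F (Y ∷ X) 0<F φ =
  blowUp-positive _ X (∏-positive Y 0<F (φ zero)) (φ ∘ suc)

-- A density p of F forces a density p ^ h ^ b of its blow-up: Hölder's inequality, one
-- coordinate at a time.
∑-blowUp : ∀ (xs : List A) .{{_ : NonZero (length xs)}} h b (F : Vec A b → ℕ) →
           ∑ (vecs xs b) F ^ (h ^ b) * (length xs ^ h) ^ b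
             ≤ (length xs ^ b) ^ (h ^ b) * ∑ (vecs (vecs xs h) b) (blowUp F)
∑-blowUp xs h zero    F = ≤-reflexive (simplify (F []))
  where
  simplify : ∀ x → (x + 0) * 1 * 1 ≡ 1 * (x + 0)
  simplify = solve-∀
∑-blowUp {A = A} xs h (suc b) F = *-cancelˡ-≤ (M ^ h) {{m^n≢0 M h {{m^n≢0 (N ^ h) b {{m^n≢0 N h}}}}}} (begin
  M ^ h * (S ^ (h * E) * (N ^ h * M))     ≡⟨ cong (λ z → M ^ h * (z * (N ^ h * M))) (^-swap S) ⟩
  M ^ h * ((S ^ E) ^ h * (N ^ h * M))     ≡⟨ arrange (M ^ h) ((S ^ E) ^ h) (N ^ h) M ⟩
  (S ^ E) ^ h * (N ^ h * M ^ h) * M       ≡⟨ cong (λ z → (S ^ E) ^ h * z * M) (^-distribʳ-* N M h) ⟨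
  (S ^ E) ^ h * (N * M) ^ h * M           ≡⟨ cong (_* M) (^-distribʳ-* (S ^ E) (N * M) h) ⟨
  (S ^ E * (N * M)) ^ h * M               ≤⟨ *-monoˡ-≤ M (^-monoˡ-≤ h inner) ⟩
  (K ^ E * T) ^ h * M                     ≡⟨ cong (_* M) (^-distribʳ-* (K ^ E) T h) ⟩
  (K ^ E) ^ h * T ^ h * M                 ≡⟨ *-assoc ((K ^ E) ^ h) (T ^ h) M ⟩
  (K ^ E) ^ h * (T ^ h * M)               ≤⟨ *-monoʳ-≤ ((K ^ E) ^ h) outer ⟩
  (K ^ E) ^ h * (M ^ h * U)               ≡⟨ arrange′ ((K ^ E) ^ h) (M ^ h) U ⟩
  M ^ h * ((K ^ E) ^ h * U)               ≡⟨ cong (λ z → M ^ h * (z * U)) (^-swap K) ⟨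
  M ^ h * (K ^ (h * E) * U)               ∎)
  where
  open ≤-Reasoning
  N = length xs
  E = h ^ b
  M = (N ^ h) ^ b
  K = N * N ^ b
  Xs = vecs (vecs xs h) b
  G : A → Vec (Vec A h) b → ℕ
  G y = blowUp (F ∘ (y ∷_))
  s t : A → ℕ
  s y = ∑ (vecs xs b) (F ∘ (y ∷_))
  t y = ∑ Xs (G y)
  S = ∑ (vecs xs (suc b)) F
  T = ∑ xs t
  U = ∑ (vecs (vecs xs h) (suc b)) (blowUp F)
  ^-swap : ∀ z → z ^ (h * E) ≡ (z ^ E) ^ h
  ^-swap z = trans (cong (z ^_) (*-comm h E)) (sym (^-*-assoc z E h))
  arrange : ∀ a b c d → a * (b * (c * d)) ≡ b * (c * a) * d
  arrange = solve-∀
  arrange′ : ∀ a b c → a * (b * c) ≡ b * (a * c)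
  arrange′ = solve-∀
  -- Convexity over the first coordinate, with the exponent that the induction hypothesis needs for
  -- the others.
  inner : S ^ E * (N * M) ≤ K ^ E * T
  inner = begin
    S ^ E * (N * M)                     ≡⟨ cong (λ z → z ^ E * (N * M)) (∑-vecs xs b F) ⟩
    ∑ xs s ^ E * (N * M)                ≡⟨ *-assoc (∑ xs s ^ E) N M ⟨
    ∑ xs s ^ E * N * M                  ≤⟨ *-monoˡ-≤ M (power-mean xs s E) ⟩
    N ^ E * ∑ xs (λ y → s y ^ E) * M    ≡⟨ *-assoc (N ^ E) _ M ⟩
    N ^ E * (∑ xs (λ y → s y ^ E) * M)  ≡⟨ cong (N ^ E *_) (∑-*ʳ M xs _) ⟨
    N ^ E * ∑ xs (λ y → s y ^ E * M)    ≤⟨ *-monoʳ-≤ (N ^ E) (∑-mono xs λ y → ∑-blowUp xs h b (F ∘ (y ∷_))) ⟩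
    N ^ E * ∑ xs (λ y → (N ^ b) ^ E * t y) ≡⟨ cong (N ^ E *_) (∑-*ˡ ((N ^ b) ^ E) xs t) ⟩
    N ^ E * ((N ^ b) ^ E * T)           ≡⟨ *-assoc (N ^ E) ((N ^ b) ^ E) T ⟨
    N ^ E * (N ^ b) ^ E * T             ≡⟨ cong (_* T) (^-distribʳ-* N (N ^ b) E) ⟨
    K ^ E * T                           ∎
  length-Xs : length Xs ≡ M
  length-Xs = trans (length-vecs (vecs xs h) b) (cong (_^ b) (length-vecs xs h))
  g : Vec (Vec A h) b → ℕ
  g X = ∑ xs (λ y → G y X)
  -- With the other classes fixed, the h entries of the first class are chosen independently, which
  -- gives an h-th power and allows a second use of convexity.
  U≡ : U ≡ ∑ Xs (λ X → g X ^ h)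
  U≡ = begin-equality
    U                                                      ≡⟨ ∑-vecs (vecs xs h) b (blowUp F) ⟩
    ∑ (vecs xs h) (λ Y → ∑ Xs (λ X → ∏ Y (λ y → G y X)))   ≡⟨ ∑-swap (vecs xs h) Xs _ ⟩
    ∑ Xs (λ X → ∑ (vecs xs h) (λ Y → ∏ Y (λ y → G y X)))   ≡⟨ ∑-cong Xs (λ X → ∑-∏ xs h (λ y → G y X)) ⟩
    ∑ Xs (λ X → g X ^ h)                                   ∎
  outer : T ^ h * M ≤ M ^ h * U
  outer = begin
    T ^ h * M                            ≡⟨ cong₂ (λ y z → y ^ h * z) (∑-swap xs Xs G) (sym length-Xs) ⟩
    ∑ Xs g ^ h * length Xs               ≤⟨ power-mean Xs g h ⟩
    length Xs ^ h * ∑ Xs (λ X → g X ^ h) ≡⟨ cong₂ (λ y z → y ^ h * z) length-Xs (sym U≡) ⟩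
    M ^ h * U                            ∎

-- Tuples with a repeated entry

allFin-length : ∀ n → length (allFin n) ≡ n
allFin-length n = length-tabulate id

∑-tabulate : ∀ {n} (h : Fin n → A) (f : A → ℕ) → ∑ (List.tabulate h) f ≡ ∑ (allFin n) (f ∘ h)
∑-tabulate {n = zero}  h f = refl
∑-tabulate {n = suc n} h f = cong (f (h zero) +_)
  (trans (∑-tabulate (h ∘ suc) f) (sym (∑-tabulate suc (f ∘ h))))

∑-allFin-suc : ∀ {n} (f : Fin (suc n) → ℕ) → ∑ (allFin (suc n)) f ≡ f zero + ∑ (allFin n) (f ∘ suc)
∑-allFin-suc f = cong (f zero +_) (∑-tabulate suc f)

count-≡ : ∀ {n} (y : Fin n) → count (Fin._≟ y) (allFin n) ≤ 1
count-≡ {suc n} zero = begin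
  count (Fin._≟ zero) (allFin (suc n))                ≡⟨ ∑-allFin-suc {n} (λ x → ⟦ x Fin.≟ zero ⟧) ⟩
  1 + ∑ (allFin n) (λ _ → 0)                     ≡⟨ cong suc (∑-const (allFin n) 0) ⟩
  1 + length (allFin n) * 0                      ≡⟨ cong suc (*-zeroʳ (length (allFin n))) ⟩
  1                                              ∎
  where open ≤-Reasoning
count-≡ {suc n} (suc y) = begin
  count (Fin._≟ suc y) (allFin (suc n))             ≡⟨ ∑-allFin-suc (λ x → ⟦ x Fin.≟ suc y ⟧) ⟩
  ∑ (allFin n) (λ x → ⟦ suc x Fin.≟ suc y ⟧)   ≡⟨ ∑-cong (allFin n) (λ x → ⟦⟧-cong (suc x Fin.≟ suc y) (x Fin.≟ y) Fin.suc-injective (cong suc)) ⟩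
  count (Fin._≟ y) (allFin n)                  ≤⟨ count-≡ y ⟩
  1                                            ∎
  where open ≤-Reasoning

module _ {n : ℕ} where

  private V = allFin n

  occurrences : ∀ {N} → Fin n → Vec (Fin n) N → ℕ
  occurrences x []      = 0
  occurrences x (y ∷ Z) = ⟦ x Fin.≟ y ⟧ + occurrences x Z

  coincidences : ∀ {N} → Vec (Fin n) N → ℕ
  coincidences []      = 0
  coincidences (x ∷ Z) = occurrences x Z + coincidences Z

  ∑-occurrences : ∀ {N} (Z : Vec (Fin n) N) → ∑ V (λ x → occurrences x Z) ≤ N
  ∑-occurrences []      = ≤-reflexive (trans (∑-const V 0) (*-zeroʳ (length V)))
  ∑-occurrences (y ∷ Z) = ≤-trans (≤-reflexive (∑-+ V _ _)) (+-mono-≤ (count-≡ y) (∑-occurrences Z))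

  -- A union bound: there are fewer than N² pairs of positions, and each pair agrees in one n-th of
  -- all tuples.
  ∑-coincidences : ∀ N → n * ∑ (vecs V N) coincidences ≤ N * N * n ^ N
  ∑-coincidences zero    = ≤-reflexive (*-zeroʳ n)
  ∑-coincidences (suc N) = begin
    n * ∑ (vecs V (suc N)) coincidences
      ≡⟨ cong (n *_) (∑-vecs V N coincidences) ⟩
    n * ∑ V (λ x → ∑ (vecs V N) (λ Z → occurrences x Z + coincidences Z))
      ≡⟨ cong (n *_) (∑-cong V λ x → ∑-+ (vecs V N) _ _) ⟩
    n * ∑ V (λ x → ∑ (vecs V N) (occurrences x) + c)
      ≡⟨ cong (n *_) (trans (∑-+ V _ _) (cong₂ _+_ (∑-swap V (vecs V N) _) (trans (∑-const V c) (cong (_* c) (allFin-length n))))) ⟩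
    n * (∑ (vecs V N) (λ Z → ∑ V (λ x → occurrences x Z)) + n * c)
      ≤⟨ *-monoʳ-≤ n (+-mono-≤ (∑-mono (vecs V N) ∑-occurrences) (∑-coincidences N)) ⟩
    n * (∑ (vecs V N) (λ _ → N) + N * N * n ^ N)
      ≡⟨ cong (λ z → n * (z + N * N * n ^ N)) (trans (∑-const (vecs V N) N)
           (cong (_* N) (trans (length-vecs V N) (cong (_^ N) (allFin-length n))))) ⟩
    n * (n ^ N * N + N * N * n ^ N)
      ≡⟨ collect n (n ^ N) N ⟩
    (N + N * N) * (n * n ^ N)
      ≤⟨ *-monoˡ-≤ (n * n ^ N) (≤-trans (m≤m+n _ (suc N)) (≤-reflexive (square N))) ⟩
    suc N * suc N * (n * n ^ N) ∎
    where
    open ≤-Reasoning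
    c = ∑ (vecs V N) coincidences
    collect : ∀ n p N → n * (p * N + N * N * p) ≡ (N + N * N) * (n * p)
    collect = solve-∀
    square : ∀ N → N + N * N + suc N ≡ suc N * suc N
    square = solve-∀

  occurrences-lookup : ∀ {N} (Z : Vec (Fin n) N) i → 0 < occurrences (lookup Z i) Z
  occurrences-lookup (y ∷ Z) zero    = ≤-trans (≤-reflexive (sym (⟦⟧-true (y Fin.≟ y) refl))) (m≤m+n _ _)
  occurrences-lookup (y ∷ Z) (suc i) = ≤-trans (occurrences-lookup Z i) (m≤n+m _ _)

  lookup-injective : ∀ {N} (Z : Vec (Fin n) N) → coincidences Z ≡ 0 → Injective _≡_ _≡_ (lookup Z)
  lookup-injective (x ∷ Z) eq {zero}  {zero}  _ = refl
  lookup-injective (x ∷ Z) eq {zero}  {suc j} x≡ = contradiction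
    (subst (λ y → 0 < occurrences y Z) (sym x≡) (occurrences-lookup Z j))
    (≤⇒≯ (≤-reflexive (m+n≡0⇒m≡0 _ eq)))
  lookup-injective (x ∷ Z) eq {suc i} {zero}  ≡x = contradiction
    (subst (λ y → 0 < occurrences y Z) ≡x (occurrences-lookup Z i))
    (≤⇒≯ (≤-reflexive (m+n≡0⇒m≡0 _ eq)))
  lookup-injective (x ∷ Z) eq {suc i} {suc j} e =
    cong suc (lookup-injective Z (m+n≡0⇒n≡0 (occurrences x Z) eq) e)

∑-concat : ∀ (xs : List A) h b (f : Vec A (b * h) → ℕ) →
           ∑ (vecs (vecs xs h) b) (f ∘ concat) ≡ ∑ (vecs xs (b * h)) f
∑-concat xs h zero    f = refl
∑-concat xs h (suc b) f = begin
  ∑ (vecs (vecs xs h) (suc b)) (f ∘ concat)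
    ≡⟨ ∑-vecs (vecs xs h) b _ ⟩
  ∑ (vecs xs h) (λ Y → ∑ (vecs (vecs xs h) b) (λ X → f (Y ++ᵥ concat X)))
    ≡⟨ ∑-cong (vecs xs h) (λ Y → ∑-concat xs h b (λ Z → f (Y ++ᵥ Z))) ⟩
  ∑ (vecs xs h) (λ Y → ∑ (vecs xs (b * h)) (λ Z → f (Y ++ᵥ Z)))
    ≡⟨ ∑-vecs-++ xs h (b * h) f ⟨
  ∑ (vecs xs (h + b * h)) f ∎
  where open ≡-Reasoning

-- Full blow-ups have density at least D^(-h^b), and on average a tuple has at most (bh)²/n
-- coincidences. If the former is larger, then some tuple has fewer coincidences than its blow-up
-- indicator, which is at most one: it has none, and its blow-up is full.
injective-blowUp : ∀ {n} h b D {P : Vec (Fin n) b → Set} (P? : Decidable P) →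
  n ^ b ≤ D * count P? (vecs (allFin n) b) →
  D ^ (h ^ b) * (b * h * (b * h)) < n →
  ∃ λ (X : Vec (Vec (Fin n) h) b) → Injective _≡_ _≡_ (lookup (concat X)) × (∀ φ → P (select X φ))
injective-blowUp {n} h b D {P} P? dense large
  with ∑ (vecs (vecs (allFin n) h) b) (coincidences ∘ concat)
         <? ∑ (vecs (vecs (allFin n) h) b) (blowUp (λ v → ⟦ P? v ⟧))
... | yes lt with ∑-<⇒∃ (vecs (vecs (allFin n) h) b) (coincidences ∘ concat) (blowUp (λ v → ⟦ P? v ⟧)) lt
...   | X , dup<blow = X
      , lookup-injective (concat X) (n≤0⇒n≡0 (≤-pred (≤-trans dup<blow (blowUp-≤1 _ X λ v → ⟦⟧≤1 (P? v)))))
      , λ φ → ⟦⟧-positive (P? _) (blowUp-positive _ X (≤-<-trans z≤n dup<blow) φ)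
injective-blowUp {n} h b D {P} P? dense large | no ≮ =
  contradiction (*-cancelʳ-≤ n _ (n ^ (b * h)) {{m^n≢0 n (b * h)}} bound) (<⇒≱ large)
  where
  open ≤-Reasoning
  instance
    n≢0 : NonZero n
    n≢0 = >-nonZero (≤-<-trans z≤n large)
  V = allFin n
  E = h ^ b
  c = count P? (vecs V b)
  β = ∑ (vecs (vecs V h) b) (blowUp (λ v → ⟦ P? v ⟧))
  γ = ∑ (vecs V (b * h)) coincidences
  rearrange : ∀ a b c → a * (b * c) ≡ b * (a * c)
  rearrange = solve-∀
  hölder : c ^ E * n ^ (b * h) ≤ (n ^ b) ^ E * β
  hölder = subst₂ _≤_
    (cong (c ^ E *_) (trans (cong (λ z → (z ^ h) ^ b) (allFin-length n)) (trans (^-*-assoc n h b) (cong (n ^_) (*-comm h b)))))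
    (cong (λ z → (z ^ b) ^ E * β) (allFin-length n))
    (∑-blowUp V {{subst NonZero (sym (allFin-length n)) n≢0}} h b (λ v → ⟦ P? v ⟧))
  density : n ^ (b * h) ≤ D ^ E * β
  density = *-cancelˡ-≤ ((n ^ b) ^ E) {{m^n≢0 (n ^ b) E {{m^n≢0 n b}}}} (begin
    (n ^ b) ^ E * n ^ (b * h)      ≤⟨ *-monoˡ-≤ (n ^ (b * h)) (^-monoˡ-≤ E dense) ⟩
    (D * c) ^ E * n ^ (b * h)      ≡⟨ cong (_* n ^ (b * h)) (^-distribʳ-* D c E) ⟩
    D ^ E * c ^ E * n ^ (b * h)    ≡⟨ *-assoc (D ^ E) (c ^ E) _ ⟩
    D ^ E * (c ^ E * n ^ (b * h))  ≤⟨ *-monoʳ-≤ (D ^ E) hölder ⟩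
    D ^ E * ((n ^ b) ^ E * β)      ≡⟨ rearrange (D ^ E) ((n ^ b) ^ E) β ⟩
    (n ^ b) ^ E * (D ^ E * β)      ∎)
  bound : n * n ^ (b * h) ≤ D ^ E * (b * h * (b * h)) * n ^ (b * h)
  bound = begin
    n * n ^ (b * h)                           ≤⟨ *-monoʳ-≤ n density ⟩
    n * (D ^ E * β)                           ≡⟨ rearrange n (D ^ E) β ⟩
    D ^ E * (n * β)                           ≤⟨ *-monoʳ-≤ (D ^ E) (*-monoʳ-≤ n (≮⇒≥ ≮)) ⟩
    D ^ E * (n * ∑ (vecs (vecs V h) b) (coincidences ∘ concat)) ≡⟨ cong (λ z → D ^ E * (n * z)) (∑-concat V h b coincidences) ⟩
    D ^ E * (n * γ)                           ≤⟨ *-monoʳ-≤ (D ^ E) (∑-coincidences (b * h)) ⟩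
    D ^ E * (b * h * (b * h) * n ^ (b * h))   ≡⟨ *-assoc (D ^ E) _ _ ⟨
    D ^ E * (b * h * (b * h)) * n ^ (b * h)   ∎

-- Walks

data Walk {X : Set} (E : Rel X 0ℓ) : ℕ → X → X → Set where
  []  : ∀ {u} → Walk E 0 u u
  _∷_ : ∀ {m u v w} → E u v → Walk E m v w → Walk E (suc m) u w

module _ {X : Set} {E : Rel X 0ℓ} where

  _++ʷ_ : ∀ {m k u v w} → Walk E m u v → Walk E k v w → Walk E (m + k) u w
  []      ++ʷ W′ = W′
  (e ∷ W) ++ʷ W′ = e ∷ (W ++ʷ W′)

  _∷ʳʷ_ : ∀ {m u v w} → Walk E m u v → E v w → Walk E (suc m) u w
  []      ∷ʳʷ e′ = e′ ∷ []
  (e ∷ W) ∷ʳʷ e′ = e ∷ (W ∷ʳʷ e′)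

  at : ∀ {m u v} → Walk E m u v → Fin m → X
  at {u = u} (e ∷ W) zero    = u
  at         (e ∷ W) (suc i) = at W i

  before : ∀ {m u v} (W : Walk E m u v) i → Walk E (toℕ i) u (at W i)
  before (e ∷ W) zero    = []
  before (e ∷ W) (suc i) = e ∷ before W i

  after : ∀ {m u v} (W : Walk E m u v) i → Walk E (m ∸ toℕ i) (at W i) v
  after (e ∷ W) zero    = e ∷ W
  after (e ∷ W) (suc i) = after W i

  between : ∀ {m u v} (W : Walk E m u v) i j → toℕ i < toℕ j →
            Walk E (toℕ j ∸ toℕ i) (at W i) (at W j)
  between (e ∷ W) zero    (suc j) i<j = e ∷ before W j
  between (e ∷ W) (suc i) (suc j) i<j = between W i j (≤-pred i<j)

  at-zero : ∀ {m u v} (W : Walk E m u v) i → toℕ i ≡ 0 → at W i ≡ u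
  at-zero (e ∷ W) zero _ = refl

  at-suc : ∀ {m u v} (W : Walk E m u v) i j → suc (toℕ i) ≡ toℕ j → E (at W i) (at W j)
  at-suc (e ∷ W) zero    (suc j) eq = subst (E _) (sym (at-zero W j (sym (suc-injective eq)))) e
  at-suc (e ∷ W) (suc i) (suc j) eq = at-suc W i j (suc-injective eq)

  at-last : ∀ {m u v} (W : Walk E m u v) i → suc (toℕ i) ≡ m → E (at W i) v
  at-last (e ∷ []) zero    _  = e
  at-last (e ∷ W)  (suc i) eq = at-last W i (suc-injective eq)

  -- Go back and forth along the first edge, which is why the walk must not be empty.
  lengthen : Symmetric E → ∀ {m u v} → Walk E (suc m) u v → ∀ k → Walk E (k + k + suc m) u v
  lengthen E-sym W       zero    = W
  lengthen E-sym {m} {u} {v} (e ∷ W) (suc k) = subst (λ l → Walk E l u v) (shift k m)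
    (e ∷ (E-sym e ∷ lengthen E-sym (e ∷ W) k))
    where
    shift : ∀ k m → suc (suc (k + k + suc m)) ≡ suc k + suc k + suc m
    shift = solve-∀

mapʷ : ∀ {X Y : Set} {E : Rel X 0ℓ} {E′ : Rel Y 0ℓ} (f : X → Y) → (∀ {u v} → E u v → E′ (f u) (f v)) →
       ∀ {m u v} → Walk E m u v → Walk E′ m (f u) (f v)
mapʷ f E⇒E′ []      = []
mapʷ f E⇒E′ (e ∷ W) = E⇒E′ e ∷ mapʷ f E⇒E′ W

-- Three hits on a closed walk of odd length cut it into three arcs, one of which is odd
-- and at least four shorter than the walk.

module _ {m : ℕ} {P : Fin (suc m) → Set} (P? : Decidable P) where

  count-suc : ∀ k → suc k ≤ count P? (allFin (suc m)) →
              (P zero × k ≤ count (P? ∘ suc) (allFin m)) ⊎ suc k ≤ count (P? ∘ suc) (allFin m)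
  count-suc k le with subst (suc k ≤_) (∑-allFin-suc (λ i → ⟦ P? i ⟧)) le
  ... | le′ with P? zero
  ...   | yes p = inj₁ (p , ≤-pred le′)
  ...   | no  _ = inj₂ le′

one-hit : ∀ {m} {P : Fin m → Set} (P? : Decidable P) → 1 ≤ count P? (allFin m) → ∃ P
one-hit {suc m} P? le with count-suc P? 0 le
... | inj₁ (p , _) = zero , p
... | inj₂ le′     = let i , p = one-hit (P? ∘ suc) le′ in suc i , p

two-hits : ∀ {m} {P : Fin m → Set} (P? : Decidable P) → 2 ≤ count P? (allFin m) →
           ∃ λ i → ∃ λ j → toℕ i < toℕ j × P i × P j
two-hits {suc m} P? le with count-suc P? 1 le
... | inj₁ (p , le′) = let i , q = one-hit (P? ∘ suc) le′ in zero , suc i , z<s , p , q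
... | inj₂ le′ = let i , j , i<j , p , q = two-hits (P? ∘ suc) le′ in suc i , suc j , s≤s i<j , p , q

three-hits : ∀ {m} {P : Fin m → Set} (P? : Decidable P) → 3 ≤ count P? (allFin m) →
             ∃ λ i → ∃ λ j → ∃ λ l → toℕ i < toℕ j × toℕ j < toℕ l × P i × P j × P l
three-hits {suc m} P? le with count-suc P? 2 le
... | inj₁ (p , le′) =
  let i , j , i<j , q , r = two-hits (P? ∘ suc) le′ in zero , suc i , suc j , z<s , s≤s i<j , p , q , r
... | inj₂ le′ =
  let i , j , l , i<j , j<l , p , q , r = three-hits (P? ∘ suc) le′
  in suc i , suc j , suc l , s≤s i<j , s≤s j<l , p , q , r

even-or-odd : ∀ a → (∃ λ x → a ≡ x + x) ⊎ (∃ λ x → a ≡ suc (x + x))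
even-or-odd zero    = inj₁ (0 , refl)
even-or-odd (suc a) with even-or-odd a
... | inj₁ (x , refl) = inj₂ (x , refl)
... | inj₂ (x , refl) = inj₁ (suc x , cong suc (sym (+-suc x x)))

double-injective : ∀ {x y} → x + x ≡ y + y → x ≡ y
double-injective {zero}  {zero}  eq = refl
double-injective {suc x} {suc y} eq = cong suc (double-injective (suc-injective
  (trans (sym (+-suc x x)) (trans (suc-injective eq) (+-suc y y)))))

double≢odd : ∀ x y → x + x ≢ suc (y + y)
double≢odd (suc x) zero    eq = contradiction (trans (sym (+-suc x x)) (suc-injective eq)) λ ()
double≢odd (suc x) (suc y) eq = double≢odd x y (suc-injective
  (trans (sym (+-suc x x)) (trans (suc-injective eq) (cong suc (+-suc y y)))))

double-cancel-< : ∀ {x y} → x + x < y + y → x < y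
double-cancel-< {x} {y} lt with x <? y
... | yes x<y = x<y
... | no  x≮y = contradiction lt (≤⇒≯ (+-mono-≤ (≮⇒≥ x≮y) (≮⇒≥ x≮y)))

-- An arc of length `d`, closed up through a common neighbour of its ends, has length d + 2. The
-- condition says that this is odd and below 2k + 1.
ShortOdd : ℕ → ℕ → Set
ShortOdd k d = ∃ λ k′ → k′ < k × 2 + d ≡ 1 + (k′ + k′)

-- Here `a` is the length of the arc minus one, and `r` is the length of the other two together
-- minus two. If `r` were zero, both would be single edges and the detour through the common
-- neighbour would gain nothing.
short-arc : ∀ {k} a r → a + r + 2 ≡ k + k → 0 < r → (∃ λ x → a ≡ x + x) → ShortOdd k (suc a)
short-arc {k} a r eq 0<r (x , refl) =
  suc x , double-cancel-< lt , cong (2 +_) (sym (+-suc x x))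
  where
  open ≤-Reasoning
  arrange : ∀ x → suc (suc x + suc x) ≡ x + x + 1 + 2
  arrange = solve-∀
  lt : suc (suc x + suc x) ≤ k + k
  lt = begin
    suc (suc x + suc x) ≡⟨ arrange x ⟩
    x + x + 1 + 2       ≤⟨ +-monoˡ-≤ 2 (+-monoʳ-≤ (x + x) 0<r) ⟩
    x + x + r + 2       ≡⟨ eq ⟩
    k + k               ∎

-- Three lengths with an odd sum include an odd one. It is short enough unless the other two arcs
-- are single edges; in that case one of these is taken instead, and `2 ≤ k` makes it short.
odd-arc : ∀ {k} a b c → suc a + suc b + suc c ≡ suc (k + k) → 2 ≤ k →
          ShortOdd k (suc a) ⊎ ShortOdd k (suc b) ⊎ ShortOdd k (suc c)
odd-arc {k} a b c eq 2≤k = go (even-or-odd a) (even-or-odd b) (even-or-odd c)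
  where
  total : a + (b + c) + 2 ≡ k + k
  total = suc-injective (trans (arrange a b c) eq)
    where
    arrange : ∀ a b c → suc (a + (b + c) + 2) ≡ suc a + suc b + suc c
    arrange = solve-∀
  totalᵇ : b + (a + c) + 2 ≡ k + k
  totalᵇ = trans (arrange a b c) total
    where
    arrange : ∀ a b c → b + (a + c) + 2 ≡ a + (b + c) + 2
    arrange = solve-∀
  totalᶜ : c + (a + b) + 2 ≡ k + k
  totalᶜ = trans (arrange a b c) total
    where
    arrange : ∀ a b c → c + (a + b) + 2 ≡ a + (b + c) + 2
    arrange = solve-∀
  a>0 : b + c ≡ 0 → 0 < a
  a>0 b+c≡0 = +-cancelʳ-< 2 0 a (<-≤-trans (s≤s (s≤s (s≤s z≤n))) (≤-trans (+-mono-≤ 2≤k 2≤k)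
    (≤-reflexive (sym (trans (cong (_+ 2) (trans (sym (+-identityʳ a)) (cong (a +_) (sym b+c≡0)))) total)))))
  go : _ → _ → _ → _
  go (inj₁ a-even) _ _ with b + c in b+c≡
  ... | suc r = inj₁ (short-arc a (suc r) (subst (λ z → a + z + 2 ≡ k + k) b+c≡ total) z<s a-even)
  ... | zero  = inj₂ (inj₁ (short-arc b (a + c) totalᵇ (≤-trans (a>0 b+c≡) (m≤m+n a c))
                  (0 , m+n≡0⇒m≡0 b b+c≡)))
  go (inj₂ (x , refl)) (inj₁ b-even) _ = inj₂ (inj₁ (short-arc b (a + c) totalᵇ z<s b-even))
  go (inj₂ (x , refl)) (inj₂ _) (inj₁ c-even) = inj₂ (inj₂ (short-arc c (a + b) totalᶜ z<s c-even))
  go (inj₂ (x , refl)) (inj₂ (y , refl)) (inj₂ (z , refl)) =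
    contradiction (trans (sym total) (arrange x y z)) (double≢odd k (x + y + z + 2))
    where
    arrange : ∀ x y z → suc (x + x) + (suc (y + y) + suc (z + z)) + 2 ≡ suc (x + y + z + 2 + (x + y + z + 2))
    arrange = solve-∀

∈-≤-∑ : ∀ {xs : List A} {x} (f : A → ℕ) → x ∈ xs → f x ≤ ∑ xs f
∈-≤-∑ f (here refl) = m≤m+n _ _
∈-≤-∑ f (there x∈)  = ≤-trans (∈-≤-∑ f x∈) (m≤n+m _ _)

-- Robust patterns

record Pattern (n b : ℕ) : Set₁ where
  field
    holds  : Vec (Fin n) b → Set
    holds? : Decidable holds

open Pattern public

module _ {n : ℕ} where

  private
    V = allFin n

  infixl 5 _∩_ _▹_ _▹₂_

  _∩_ : ∀ {b} → Pattern n b → Pattern n b → Pattern n b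
  P ∩ Q = record
    { holds  = λ xs → holds P xs × holds Q xs
    ; holds? = λ xs → holds? P xs ×-dec holds? Q xs
    }

  private
    Holds▹ : ∀ {b} → Pattern n b → (Fin n → Pattern n b) → Vec (Fin n) (suc b) → Set
    Holds▹ P T (x ∷ xs) = holds P xs × holds (T x) xs

    holds▹? : ∀ {b} (P : Pattern n b) T → Decidable (Holds▹ P T)
    holds▹? P T (x ∷ xs) = holds? P xs ×-dec holds? (T x) xs

  _▹_ : ∀ {b} → Pattern n b → (Fin n → Pattern n b) → Pattern n (suc b)
  P ▹ T = record { holds = Holds▹ P T ; holds? = holds▹? P T }

  anything : ∀ {b} → Pattern n b
  anything = record { holds = λ _ → ⊤ ; holds? = λ _ → yes tt }

  Robust : ∀ {b} → Pattern n b → ℕ → Set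
  Robust {b} P D = n ^ b ≤ D * count (holds? P) (vecs V b)

  robust-mono : ∀ {b} (P : Pattern n b) {D D′} → D ≤ D′ → Robust P D → Robust P D′
  robust-mono P D≤D′ robust = ≤-trans robust (*-monoˡ-≤ _ D≤D′)

  -- Double counting of pairs of a tuple and an extension. `N` is n when one vertex is added and n²
  -- when two are added together.
  extend-count : ∀ {B : Set} {b} (P : Pattern n b) (ys : List B) (T : B → Pattern n b) N c D →
    (∀ xs → holds P xs → N ≤ c * ∑ ys (λ y → ⟦ holds? (T y) xs ⟧)) → Robust P D →
    N * n ^ b ≤ D * c * ∑ ys (λ y → ∑ (vecs V b) (λ xs → ⟦ holds? P xs ×-dec holds? (T y) xs ⟧))
  extend-count {b = b} P ys T N c D many robust = begin
    N * n ^ b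
      ≤⟨ *-monoʳ-≤ N robust ⟩
    N * (D * ∑ Xs (λ xs → ⟦ holds? P xs ⟧))
      ≡⟨ trans (rearrange N D _) (cong (D *_) (sym (∑-*ʳ N Xs _))) ⟩
    D * ∑ Xs (λ xs → ⟦ holds? P xs ⟧ * N)
      ≤⟨ *-monoʳ-≤ D (∑-mono Xs pointwise) ⟩
    D * ∑ Xs (λ xs → c * ∑ ys (λ y → ⟦ holds? P xs ×-dec holds? (T y) xs ⟧))
      ≡⟨ trans (cong (D *_) (∑-*ˡ c Xs _)) (sym (*-assoc D c _)) ⟩
    D * c * ∑ Xs (λ xs → ∑ ys (λ y → ⟦ holds? P xs ×-dec holds? (T y) xs ⟧))
      ≡⟨ cong (D * c *_) (∑-swap Xs ys _) ⟩
    D * c * ∑ ys (λ y → ∑ Xs (λ xs → ⟦ holds? P xs ×-dec holds? (T y) xs ⟧)) ∎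
    where
    open ≤-Reasoning
    Xs = vecs V b
    rearrange : ∀ a b c → a * (b * c) ≡ b * (c * a)
    rearrange = solve-∀
    pointwise : ∀ xs → ⟦ holds? P xs ⟧ * N ≤ c * ∑ ys (λ y → ⟦ holds? P xs ×-dec holds? (T y) xs ⟧)
    pointwise xs with holds? P xs
    ... | no  _ = z≤n
    ... | yes p = ≤-trans (≤-reflexive (*-identityˡ N)) (≤-trans (many xs p)
          (*-monoʳ-≤ c (∑-mono ys λ y → ⟦⟧-mono (holds? (T y) xs) (yes p ×-dec holds? (T y) xs) (p ,_))))

  extend-robust : ∀ {b} (P : Pattern n b) T c D →
    (∀ xs → holds P xs → n ≤ c * count (λ x → holds? (T x) xs) V) →
    Robust P D → Robust (P ▹ T) (D * c)
  extend-robust {b} P T c D many robust =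
    ≤-trans (extend-count P V T n c D many robust)
      (≤-reflexive (cong (D * c *_) (sym (∑-vecs V b _))))

  -- An unconstrained coordinate. Procedures that stop early use it to end with the number of
  -- coordinates fixed in advance.
  pad : ∀ {b} → Pattern n b → Pattern n (suc b)
  pad P = P ▹ λ _ → anything

  pad-robust : ∀ {b} (P : Pattern n b) D → Robust P D → Robust (pad P) D
  pad-robust P D robust = robust-mono (pad P) (≤-reflexive (*-identityʳ D))
    (extend-robust P (λ _ → anything) 1 D (λ _ _ → ≤-reflexive (sym all)) robust)
    where
    all : 1 * count (λ _ → yes tt) V ≡ n
    all = trans (*-identityˡ _) (trans (sym (length≡∑1 V)) (allFin-length n))

  -- For a dense pair of centres only the number of edges between the classes is bounded below, so
  -- both ends of an edge must be chosen in one step.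
  _▹₂_ : ∀ {b} → Pattern n b → (Fin n → Fin n → Pattern n b) → Pattern n (suc (suc b))
  P ▹₂ T = record { holds = holds₂ ; holds? = holds₂? }
    where
    holds₂ : Vec (Fin n) _ → Set
    holds₂ (x ∷ y ∷ xs) = holds P xs × holds (T x y) xs
    holds₂? : Decidable holds₂
    holds₂? (x ∷ y ∷ xs) = holds? P xs ×-dec holds? (T x y) xs

  extend₂-robust : ∀ {b} (P : Pattern n b) T c D →
    (∀ xs → holds P xs → n * n ≤ c * ∑ V (λ x → count (λ y → holds? (T x y) xs) V)) →
    Robust P D → Robust (P ▹₂ T) (D * c)
  extend₂-robust {b} P T c D many robust = begin
    n * (n * n ^ b)  ≡⟨ *-assoc n n (n ^ b) ⟨
    n * n * n ^ b    ≤⟨ extend-count P (vecs V 2) T₂ (n * n) c D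
                          (λ xs p → subst (λ z → n * n ≤ c * z) (sym (pairs _)) (many xs p)) robust ⟩
    D * c * ∑ (vecs V 2) (λ y → ∑ (vecs V b) (λ xs → ⟦ holds? P xs ×-dec holds? (T₂ y) xs ⟧))
      ≡⟨ cong (D * c *_) (pairs _) ⟩
    D * c * ∑ V (λ x → ∑ V (λ y → ∑ (vecs V b) (λ xs → ⟦ holds? P xs ×-dec holds? (T x y) xs ⟧)))
      ≡⟨ cong (D * c *_) (trans (∑-vecs V (suc b) _) (∑-cong V λ x → ∑-vecs V b _)) ⟨
    D * c * count (holds? (P ▹₂ T)) (vecs V (suc (suc b))) ∎
    where
    open ≤-Reasoning
    T₂ : Vec (Fin n) 2 → Pattern n b
    T₂ (x ∷ y ∷ []) = T x y
    pairs : ∀ (f : Vec (Fin n) 2 → ℕ) → ∑ (vecs V 2) f ≡ ∑ V (λ x → ∑ V (λ y → f (x ∷ y ∷ [])))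
    pairs f = trans (∑-vecs V 1 f) (∑-cong V λ x → trans (∑-vecs V 0 _) (∑-cong V λ y → +-identityʳ _))

  module _ .{{_ : NonZero n}} where

    nonempty : ∀ {b} (P : Pattern n b) D → Robust P D → ∃ (holds P)
    nonempty {b} P D robust with count (holds? P) (vecs V b) in eq
    ... | zero  = contradiction (≤-trans robust (≤-reflexive (*-zeroʳ D))) (<⇒≱ (m^n>0 n b))
    ... | suc _ with ∑-<⇒∃ (vecs V b) (λ _ → 0) (λ xs → ⟦ holds? P xs ⟧)
                   (subst₂ _<_ (sym (trans (∑-const (vecs V b) 0) (*-zeroʳ (length (vecs V b))))) (sym eq) z<s)
    ...   | xs , 0<1 = xs , ⟦⟧-positive (holds? P xs) 0<1

    -- The case may vary with the tuple. Restricting to a case of at least average frequency makes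
    -- it the same for all tuples that remain.
    pigeonhole : ∀ {I : Set} {b} (P : Pattern n b) (is : List I) (T : I → Pattern n b) D →
      (∀ xs → holds P xs → ∃ λ i → i ∈ is × holds (T i) xs) →
      Robust P D → ∃ λ i → Robust (P ∩ T i) (D * length is)
    pigeonhole P []       T D covers robust with nonempty P D robust
    ... | xs , p with covers xs p
    ...   | _ , () , _
    pigeonhole {b = b} P (i ∷ is) T D covers robust with ∑-average i is (λ i → count (holds? (P ∩ T i)) (vecs V b))
    ... | j , ∑≤ = j , (begin
        n ^ b                                                    ≤⟨ robust ⟩
        D * count (holds? P) Xs                                  ≤⟨ *-monoʳ-≤ D (∑-mono Xs pointwise) ⟩
        D * ∑ Xs (λ xs → ∑ (i ∷ is) (λ i → ⟦ holds? (P ∩ T i) xs ⟧)) ≡⟨ cong (D *_) (∑-swap Xs (i ∷ is) _) ⟩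
        D * ∑ (i ∷ is) (λ i → count (holds? (P ∩ T i)) Xs)         ≤⟨ *-monoʳ-≤ D ∑≤ ⟩
        D * (length (i ∷ is) * count (holds? (P ∩ T j)) Xs)      ≡⟨ *-assoc D _ _ ⟨
        D * length (i ∷ is) * count (holds? (P ∩ T j)) Xs        ∎)
      where
      open ≤-Reasoning
      Xs = vecs V b
      pointwise : ∀ xs → ⟦ holds? P xs ⟧ ≤ ∑ (i ∷ is) (λ i → ⟦ holds? (P ∩ T i) xs ⟧)
      pointwise xs = ⟦⟧-≤ (holds? P xs) λ p → let l , l∈ , t = covers xs p in
        ≤-trans (≤-reflexive (sym (⟦⟧-true (holds? (P ∩ T l) xs) (p , t))))
                (∈-≤-∑ (λ i → ⟦ holds? (P ∩ T i) xs ⟧) l∈)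

-- Shortening odd closed walks, and embedding H

length-product : ∀ {A B C : Set} (f : A → B → C) xs ys → length (cartesianProductWith f xs ys) ≡ length xs * length ys
length-product f xs ys = begin
  length (cartesianProductWith f xs ys)          ≡⟨ length≡∑1 (cartesianProductWith f xs ys) ⟩
  ∑ (cartesianProductWith f xs ys) (λ _ → 1)     ≡⟨ ∑-product f xs ys _ ⟩
  ∑ xs (λ _ → ∑ ys (λ _ → 1))                    ≡⟨ ∑-const xs _ ⟩
  length xs * ∑ ys (λ _ → 1)                     ≡⟨ cong (length xs *_) (length≡∑1 ys) ⟨
  length xs * length ys                          ∎
  where open ≡-Reasoning

gap : ∀ i a → suc i + a ∸ i ≡ suc a
gap i a = trans (cong (_∸ i) (sym (+-suc i a))) (m+n∸m≡n i (suc a))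

-- The form of `odd-arc` for positions on the walk; the third arc wraps around the base point.
cyclic-arcs : ∀ {k i j l} → i < j → j < l → l < suc (k + k) → 2 ≤ k →
              ShortOdd k (j ∸ i) ⊎ ShortOdd k (l ∸ j) ⊎ ShortOdd k (suc (k + k) ∸ l + i)
cyclic-arcs {k} {i} i<j j<l l<m 2≤k
  with m≤n⇒∃[o]m+o≡n i<j | m≤n⇒∃[o]m+o≡n j<l | m≤n⇒∃[o]m+o≡n l<m
... | a , refl | b , refl | c , eq with odd-arc a b (c + i) (trans (arrange i a b c) eq) 2≤k
  where
  arrange : ∀ i a b c → suc a + suc b + suc (c + i) ≡ suc (suc (suc i + a) + b) + c
  arrange = solve-∀
... | inj₁ odd = inj₁ (subst (ShortOdd k) (sym (gap i a)) odd)
... | inj₂ (inj₁ odd) = inj₂ (inj₁ (subst (ShortOdd k) (sym (gap (suc i + a) b)) odd))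
... | inj₂ (inj₂ odd) = inj₂ (inj₂ (subst (ShortOdd k) (sym (trans
        (cong (λ m → m ∸ l + i) (sym eq)) (cong (_+ i) (gap l c)))) odd))
  where l = suc (suc i + a) + b

module _ {n : ℕ} (G : Graph n) where
  open Graph G using (_~_; _~?_)

  private
    V = allFin n

  -- A relation on coordinates: every tuple of the pattern turns a walk of forced pairs into a walk
  -- in G.
  Forced : ∀ {b} → Pattern n b → Rel (Fin b) 0ℓ
  Forced P p q = ∀ xs → holds P xs → lookup xs p ~ lookup xs q

  Forced-sym : ∀ {b} (P : Pattern n b) → Symmetric (Forced P)
  Forced-sym P forced xs h = ~-sym G (forced xs h)

  -- The degree hypothesis of the theorem with denominators cleared: ε is at least 1 / L.
  module _ .{{_ : NonZero n}} {g L : ℕ}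
           (large-degree : ∀ v → (2 * L + 1) * n ≤ suc (g + g) * L * count (v ~?_) V) where

    -- The new coordinate is a vertex adjacent to three positions of the walk, counted with
    -- repetition. Which two of them bound a short odd arc depends on the tuple, so `pigeonhole`
    -- over all pairs of positions fixes them; this is the last factor of the loss.
    shorten : ∀ {b} (P : Pattern n b) D k {p} → Robust P D → Walk (Forced P) (suc (k + k)) p p →
      2 ≤ k → g ≤ k →
      ∃ λ (P′ : Pattern n (suc b)) →
        Robust P′ (D * (L * suc (k + k)) * (suc (k + k) * suc (k + k))) ×
        ∃ λ k′ → ∃ λ p′ → k′ < k × Walk (Forced P′) (suc (k′ + k′)) p′ p′
    shorten {b} P D k {p} robust W 2≤k g≤k = result
      where
      m = suc (k + k)
      vertex : Vec (Fin n) b → Fin m → Fin n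
      vertex xs i = lookup xs (at W i)
      hits : Fin n → Vec (Fin n) b → ℕ
      hits x xs = count (λ i → vertex xs i ~? x) (allFin m)
      hits≤m : ∀ x xs → hits x xs ≤ m
      hits≤m x xs = ≤-trans (∑-mono (allFin m) λ i → ⟦⟧≤1 (vertex xs i ~? x))
        (≤-reflexive (trans (sym (length≡∑1 (allFin m))) (allFin-length m)))
      Hit : Fin n → Pattern n b
      Hit x = record { holds = λ xs → 3 ≤ hits x xs ; holds? = λ xs → 3 ≤? hits x xs }
      s = suc (g + g)
      hits-sum : ∀ xs → (2 * L + 1) * n ≤ L * ∑ V (λ x → hits x xs)
      hits-sum xs = *-cancelˡ-≤ s (begin
        s * ((2 * L + 1) * n)
          ≤⟨ *-monoˡ-≤ _ (s≤s (+-mono-≤ g≤k g≤k)) ⟩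
        m * ((2 * L + 1) * n)
          ≡⟨ trans (cong (_* ((2 * L + 1) * n)) (sym (allFin-length m))) (sym (∑-const (allFin m) _)) ⟩
        ∑ (allFin m) (λ _ → (2 * L + 1) * n)
          ≤⟨ ∑-mono (allFin m) (λ i → large-degree (vertex xs i)) ⟩
        ∑ (allFin m) (λ i → s * L * count (vertex xs i ~?_) V)
          ≡⟨ ∑-*ˡ (s * L) (allFin m) _ ⟩
        s * L * ∑ (allFin m) (λ i → count (vertex xs i ~?_) V)
          ≡⟨ cong (s * L *_) (∑-swap (allFin m) V _) ⟩
        s * L * ∑ V (λ x → hits x xs)
          ≡⟨ *-assoc s L _ ⟩
        s * (L * ∑ V (λ x → hits x xs)) ∎)
        where open ≤-Reasoning
      many : ∀ xs → holds P xs → n ≤ L * m * count (λ x → holds? (Hit x) xs) V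
      -- Two hits per vertex account for 2n of the total. The surplus of n / L comes from vertices
      -- with at least three hits, and each of these has at most `m`.
      many xs _ = +-cancelˡ-≤ (2 * L * n) _ _ (begin
        2 * L * n + n                            ≡⟨ factor (2 * L) n ⟨
        (2 * L + 1) * n                          ≤⟨ hits-sum xs ⟩
        L * ∑ V (λ x → hits x xs)                ≤⟨ *-monoʳ-≤ L (∑-mono V pointwise) ⟩
        L * ∑ V (λ x → 2 + m * ⟦ 3 ≤? hits x xs ⟧) ≡⟨ cong (L *_) (∑-+ V (λ _ → 2) _) ⟩
        L * (∑ V (λ _ → 2) + ∑ V (λ x → m * ⟦ 3 ≤? hits x xs ⟧))
          ≡⟨ cong (L *_) (cong₂ _+_ (trans (∑-const V 2) (cong (_* 2) (allFin-length n))) (∑-*ˡ m V _)) ⟩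
        L * (n * 2 + m * c)                      ≡⟨ expand L n m c ⟩
        2 * L * n + L * m * c                    ∎)
        where
        open ≤-Reasoning
        c = count (λ x → holds? (Hit x) xs) V
        factor : ∀ a n → (a + 1) * n ≡ a * n + n
        factor = solve-∀
        expand : ∀ L n m c → L * (n * 2 + m * c) ≡ 2 * L * n + L * m * c
        expand = solve-∀
        pointwise : ∀ x → hits x xs ≤ 2 + m * ⟦ 3 ≤? hits x xs ⟧
        pointwise x with 3 ≤? hits x xs
        ... | yes ≥3 = ≤-trans (hits≤m x xs) (≤-trans (≤-reflexive (sym (trans
                         (cong (m *_) (⟦⟧-true (3 ≤? hits x xs) ≥3)) (*-identityʳ m)))) (m≤n+m _ 2))
        ... | no  ≱3 = ≤-trans (≤-pred (≰⇒> ≱3)) (m≤m+n 2 _)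
      P₁ = P ▹ Hit
      -- The second kind of arc leaves j, passes the base point of the walk and ends at i.
      ArcAt : Fin m → Fin m → Set
      ArcAt i j = toℕ i < toℕ j × (ShortOdd k (toℕ j ∸ toℕ i) ⊎ ShortOdd k (m ∸ toℕ j + toℕ i))
      Chord : Fin m × Fin m → Pattern n (suc b)
      Chord (i , j) = record
        { holds  = λ ys → ArcAt i j × lookup ys (suc (at W i)) ~ lookup ys zero
                                    × lookup ys (suc (at W j)) ~ lookup ys zero
        ; holds? = λ ys →
            ((toℕ i <? toℕ j) ×-dec (short-odd? (toℕ j ∸ toℕ i) ⊎-dec short-odd? (m ∸ toℕ j + toℕ i)))
            ×-dec ((lookup ys (suc (at W i)) ~? lookup ys zero) ×-dec (lookup ys (suc (at W j)) ~? lookup ys zero))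
        }
        where
        short-odd? : ∀ d → Dec (ShortOdd k d)
        short-odd? d = anyUpTo? (λ k′ → 2 + d ≟ 1 + (k′ + k′)) k
      chords = cartesianProduct (allFin m) (allFin m)
      covers : ∀ ys → holds P₁ ys → ∃ λ c → c ∈ chords × holds (Chord c) ys
      covers (x ∷ xs) (_ , 3≤) with three-hits (λ i → vertex xs i ~? x) 3≤
      ... | i , j , l , i<j , j<l , ~i , ~j , ~l with cyclic-arcs i<j j<l (Fin.toℕ<n l) 2≤k
      ...   | inj₁ ij        = _ , ∈-cartesianProduct⁺ (∈-allFin i) (∈-allFin j) , (i<j , inj₁ ij) , ~i , ~j
      ...   | inj₂ (inj₁ jl) = _ , ∈-cartesianProduct⁺ (∈-allFin j) (∈-allFin l) , (j<l , inj₁ jl) , ~j , ~l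
      ...   | inj₂ (inj₂ li) = _ , ∈-cartesianProduct⁺ (∈-allFin i) (∈-allFin l) , (<-trans i<j j<l , inj₂ li) , ~i , ~l
      length-chords : length chords ≡ m * m
      length-chords = trans (length-product _,_ (allFin m) (allFin m)) (cong₂ _*_ (allFin-length m) (allFin-length m))
      shortened : (∃ λ c → Robust (P₁ ∩ Chord c) (D * (L * m) * length chords)) → _
      shortened ((i , j) , robust₂) =
        P₂ , subst (Robust P₂) (cong (D * (L * m) *_) length-chords) robust₂ , cut (proj₁ (proj₂ (proj₂ sample)))
        where
        P₂ = P₁ ∩ Chord (i , j)
        -- `ArcAt` does not mention the tuple, so one tuple of the pattern suffices to read it off.
        sample = nonempty P₂ (D * (L * m) * length chords) robust₂
        lift : ∀ {p q} → Forced P p q → Forced P₂ (suc p) (suc q)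
        lift forced (x ∷ xs) ((h , _) , _) = forced xs h
        enter : ∀ {p} → (∀ ys → holds P₂ ys → lookup ys (suc p) ~ lookup ys zero) → Forced P₂ zero (suc p)
        enter forced ys h = ~-sym G (forced ys h)
        ~i : Forced P₂ (suc (at W i)) zero
        ~i ys (_ , _ , ~x , _) = ~x
        ~j : Forced P₂ (suc (at W j)) zero
        ~j ys (_ , _ , _ , ~x) = ~x
        cut : ArcAt i j → ∃ λ k′ → ∃ λ p′ → k′ < k × Walk (Forced P₂) (suc (k′ + k′)) p′ p′
        cut (i<j , inj₁ (k′ , k′<k , eq)) = k′ , zero , k′<k ,
          subst (λ l → Walk (Forced P₂) l zero zero) eq
            (enter ~i ∷ (mapʷ suc lift (between W i j i<j) ∷ʳʷ ~j))
        cut (i<j , inj₂ (k′ , k′<k , eq)) = k′ , zero , k′<k ,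
          subst (λ l → Walk (Forced P₂) l zero zero) eq
            (enter ~j ∷ (mapʷ suc lift (after W j ++ʷ before W i) ∷ʳʷ ~i))
      result = shortened (pigeonhole P₁ chords Chord (D * (L * m)) covers (extend-robust P Hit (L * m) D many robust))

    -- The number of coordinates is prescribed exactly, since it enters the exponent of the blow-up.
    Shortened : (κ γ b D r : ℕ) → Set₁
    Shortened κ γ b D r = ∃ λ b′ → b′ ≡ r + b × ∃ λ (P : Pattern n b′) →
      Robust P (D * κ ^ r) × ∃ λ p → Walk (Forced P) (suc (γ + γ)) p p

    private
      after-step : ∀ {κ γ b D r} → Shortened κ γ (suc b) (D * κ) r → Shortened κ γ b D (suc r)
      after-step {κ} {b = b} {D} {r} (b′ , b′≡ , P , robust , W) =
        b′ , trans b′≡ (+-suc r b) , P , subst (Robust P) (*-assoc D κ (κ ^ r)) robust , W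

    -- At most `r` rounds remain while k ≤ γ + r. A round either shortens the walk or, when it is
    -- already short enough, pads the pattern. A walk that falls below the target is lengthened at
    -- the end. `κ` bounds the cost of a round for every length up to 2K + 1.
    shortenTo : ∀ r κ {b γ K} → L * suc (K + K) * (suc (K + K) * suc (K + K)) ≤ κ → 1 ≤ κ →
      ∀ (P : Pattern n b) D k {p} → g ≡ suc γ → 1 ≤ γ → Robust P D →
      Walk (Forced P) (suc (k + k)) p p → k ≤ γ + r → k ≤ K →
      Shortened κ γ b D r
    shortenTo zero κ {b} {γ} _ _ P D k {p} _ _ robust W k≤γ _ with m≤n⇒∃[o]m+o≡n (≤-trans k≤γ (≤-reflexive (+-identityʳ γ)))
    ... | d , refl = b , refl , P , subst (Robust P) (sym (*-identityʳ D)) robust , p ,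
          subst (λ l → Walk (Forced P) l p p) (arrange d k) (lengthen (λ {u} {v} → Forced-sym P {u} {v}) W d)
      where
      arrange : ∀ d k → d + d + suc (k + k) ≡ suc (k + d + (k + d))
      arrange = solve-∀
    shortenTo (suc r) κ {b} {γ} {K} κ≥ 1≤κ P D k {p} g≡ 1≤γ robust W k≤ k≤K with k ≤? γ + r
    ... | yes k≤γ+r = after-step {κ} {γ} {b} {D} (shortenTo r κ κ≥ 1≤κ (pad P) (D * κ) k g≡ 1≤γ
            (robust-mono (pad P) (≤-trans (≤-reflexive (sym (*-identityʳ D))) (*-monoʳ-≤ D 1≤κ)) (pad-robust P D robust))
            (mapʷ suc (λ {u} {v} → lift {u} {v}) W) k≤γ+r k≤K)
      where
      lift : ∀ {u v} → Forced P u v → Forced (pad P) (suc u) (suc v)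
      lift forced (x ∷ xs) (h , _) = forced xs h
    ... | no  k≰γ+r = continue (shorten P D k robust W
            (≤-trans (s≤s 1≤γ) g≤k) (≤-trans (≤-reflexive g≡) g≤k))
      where
      g≤k : suc γ ≤ k
      g≤k = ≤-trans (s≤s (m≤m+n γ r)) (≰⇒> k≰γ+r)
      m≤M : suc (k + k) ≤ suc (K + K)
      m≤M = s≤s (+-mono-≤ k≤K k≤K)
      bound : D * (L * suc (k + k)) * (suc (k + k) * suc (k + k)) ≤ D * κ
      bound = ≤-trans (≤-reflexive (*-assoc D _ _))
        (*-monoʳ-≤ D (≤-trans (*-mono-≤ (*-monoʳ-≤ L m≤M) (*-mono-≤ m≤M m≤M)) κ≥))
      continue : _ → Shortened κ γ b D (suc r)
      continue (P₁ , robust₁ , k′ , p′ , k′<k , W₁) = after-step {κ} {γ} {b} {D} (shortenTo r κ κ≥ 1≤κ P₁ (D * κ) k′ g≡ 1≤γ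
            (robust-mono P₁ bound robust₁) W₁
            (≤-pred (≤-trans k′<k (≤-trans k≤ (≤-reflexive (+-suc γ r))))) (≤-trans (<⇒≤ k′<k) k≤K))

  -- Each class of the blow-up has one slot per vertex of H, and a vertex always takes its own slot.
  -- Thus distinct vertices stay distinct even if they are sent to the same coordinate, or the walk
  -- visits a coordinate twice.
  embedding : ∀ {h b m} (H : Graph h) → H ⟶ Cycle m → (P : Pattern n b) (D : ℕ) → Robust P D →
    ∀ {p} → Walk (Forced P) m p p → D ^ (h ^ b) * (b * h * (b * h)) < n → ¬ (H -free G)
  embedding {h} {b} {m} H (f , f-hom) P D robust W large free
    with injective-blowUp h b D (holds? P) robust large
  ... | X , X-injective , X-holds = free (place , place-injective , place-hom)
    where
    place : Fin h → Fin n
    place v = lookup (concat X) (Fin.combine (at W (f v)) v)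
    place-injective : Injective _≡_ _≡_ place
    place-injective {u} {v} eq = Fin.combine-injectiveʳ (at W (f u)) u (at W (f v)) v (X-injective eq)
    cycle-edge : ∀ {i j} → Graph._~_ (Cycle m) i j → Forced P (at W i) (at W j)
    cycle-edge {i} {j} (_ , inj₁ (inj₁ eq))         = at-suc W i j eq
    cycle-edge {i} {j} (_ , inj₁ (inj₂ (i≡ , j≡0))) = subst (Forced P (at W i)) (sym (at-zero W j j≡0)) (at-last W i i≡)
    cycle-edge {i} {j} (_ , inj₂ (inj₁ eq))         = Forced-sym P {at W j} (at-suc W j i eq)
    cycle-edge {i} {j} (_ , inj₂ (inj₂ (j≡ , i≡0))) =
      Forced-sym P {at W j} (subst (Forced P (at W j)) (sym (at-zero W i i≡0)) (at-last W j j≡))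
    place-edge : ∀ {p q} u v → Forced P p q →
                 lookup (concat X) (Fin.combine p u) ~ lookup (concat X) (Fin.combine q v)
    place-edge {p} {q} u v forced = subst₂ _~_ (entry p u φp) (entry q v φq) (forced (select X φ) (X-holds φ))
      where
      -- One selection must contain both images, so it takes slot `u` at `p` and slot `v` at every
      -- other coordinate.
      φ : Fin b → Fin h
      φ i = if does (i Fin.≟ p) then u else v
      φp : φ p ≡ u
      φp = cong (if_then u else v) (dec-true (p Fin.≟ p) refl)
      -- A coordinate forced to be adjacent to itself would give a loop in G.
      q≢p : q ≢ p
      q≢p refl = ~-irrefl G refl (forced (select X (const u)) (X-holds (const u)))
      φq : φ q ≡ v
      φq = cong (if_then u else v) (dec-false (q Fin.≟ p) q≢p)
      entry : ∀ r w → φ r ≡ w → lookup (select X φ) r ≡ lookup (concat X) (Fin.combine r w)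
      entry r w refl = trans (lookup-select X φ r) (sym (lookup-concat X r (φ r)))
    place-hom : IsHom H G place
    place-hom {u} {v} u~v = place-edge u v (cycle-edge (f-hom u~v))

-- Two-colourings and odd closed walks

∃Bool? : {P : Bool → Set} → (∀ b → Dec (P b)) → Dec (∃ P)
∃Bool? {P} P? = map′ from to (P? true ⊎-dec P? false)
  where
  from : P true ⊎ P false → ∃ P
  from (inj₁ p) = true , p
  from (inj₂ p) = false , p
  to : ∃ P → P true ⊎ P false
  to (true  , p) = inj₁ p
  to (false , p) = inj₂ p

xor-cancelˡ : ∀ τ σ → τ xor (τ xor σ) ≡ σ
xor-cancelˡ false σ     = refl
xor-cancelˡ true  false = refl
xor-cancelˡ true  true  = refl

xor-transpose : ∀ a b τ σ → a xor b ≡ τ xor σ → b xor (a xor τ) ≡ σ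
xor-transpose a b τ σ eq = begin
  b xor (a xor τ)      ≡⟨ Bool.xor-assoc b a τ ⟨
  (b xor a) xor τ      ≡⟨ cong (_xor τ) (trans (Bool.xor-comm b a) eq) ⟩
  (τ xor σ) xor τ      ≡⟨ Bool.xor-comm (τ xor σ) τ ⟩
  τ xor (τ xor σ)      ≡⟨ xor-cancelˡ τ σ ⟩
  σ                    ∎
  where open ≡-Reasoning

-- A system of constraints c u xor c v ≡ σ is solved by eliminating one vertex at a time;
-- each constraint carries a walk of parity σ, so an unsolvable one yields a closed odd walk.
module _ {X : Set} (Link : ℕ → Bool → X → X → Set)
  (compose : ∀ {k σ τ u v w} → Link k σ u v → Link k τ v w → Link (suc k) (σ xor τ) u w)
  (weaken : ∀ {k σ u v} → Link k σ u v → Link (suc k) σ u v) where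

  weaken* : ∀ j {k σ u v} → Link k σ u v → Link (j + k) σ u v
  weaken* zero    l = l
  weaken* (suc j) l = weaken (weaken* j l)

  eliminate : ∀ j k (ι : Fin j → X) (S : Bool → Rel (Fin j) 0ℓ) → (∀ σ → Binary.Decidable (S σ)) →
    (∀ σ → Symmetric (S σ)) → (∀ {σ u v} → S σ u v → Link k σ (ι u) (ι v)) →
    (∃ λ (c : Fin j → Bool) → ∀ {σ u v} → S σ u v → c u xor c v ≡ σ) ⊎ (∃ λ x → Link (j + k) true x x)
  eliminate zero k ι S S? S-sym sound = inj₁ ((λ ()) , λ { {u = ()} })
  eliminate (suc j) k ι S S? S-sym sound with S? true zero zero
  ... | yes s = inj₂ (ι zero , weaken* (suc j) (sound s))
  ... | no ¬s with eliminate j (suc k) (ι ∘ suc) S′ S′? S′-sym sound′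
    where
    -- A path through the eliminated vertex becomes a direct constraint whose parity is the sum of
    -- the two.
    Via : Bool → Fin j → Fin j → Bool → Set
    Via σ u v τ = S τ (suc u) zero × S (τ xor σ) zero (suc v)
    S′ : Bool → Rel (Fin j) 0ℓ
    S′ σ u v = S σ (suc u) (suc v) ⊎ ∃ (Via σ u v)
    S′? : ∀ σ → Binary.Decidable (S′ σ)
    S′? σ u v = S? σ (suc u) (suc v) ⊎-dec ∃Bool? λ τ → S? τ (suc u) zero ×-dec S? (τ xor σ) zero (suc v)
    S′-sym : ∀ σ → Symmetric (S′ σ)
    S′-sym σ (inj₁ s) = inj₁ (S-sym σ s)
    S′-sym σ {u} (inj₂ (τ , s , s′)) = inj₂ (τ xor σ , S-sym _ s′ ,
      subst (λ ρ → S ρ zero (suc u)) (sym involution) (S-sym τ s))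
      where
      involution : (τ xor σ) xor σ ≡ τ
      involution = trans (Bool.xor-comm (τ xor σ) σ) (trans (cong (σ xor_) (Bool.xor-comm τ σ)) (xor-cancelˡ σ τ))
    sound′ : ∀ {σ u v} → S′ σ u v → Link (suc k) σ (ι (suc u)) (ι (suc v))
    sound′ (inj₁ s) = weaken (sound s)
    sound′ {σ} {u} {v} (inj₂ (τ , s , s′)) =
      subst (λ ρ → Link (suc k) ρ (ι (suc u)) (ι (suc v))) (xor-cancelˡ τ σ) (compose (sound s) (sound s′))
  ...   | inj₂ (x , l) = inj₂ (x , subst (λ i → Link i true x x) (+-suc j k) l)
  ...   | inj₁ (c , c-solves)
          with Fin.any? (λ u → ∃Bool? (λ τ → S? τ (suc u) zero))
  ...     | no isolated = inj₁ (c′ , c′-solves)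
    where
    c′ : Fin (suc j) → Bool
    c′ zero    = false
    c′ (suc u) = c u
    c′-solves : ∀ {σ u v} → S σ u v → c′ u xor c′ v ≡ σ
    c′-solves {false} {zero}  {zero}  s = refl
    c′-solves {true}  {zero}  {zero}  s = contradiction s ¬s
    c′-solves {σ}     {zero}  {suc v} s = contradiction (v , σ , S-sym σ s) isolated
    c′-solves {σ}     {suc u} {zero}  s = contradiction (u , σ , s) isolated
    c′-solves {σ}     {suc u} {suc v} s = c-solves (inj₁ s)
  ...     | yes (u₀ , τ , s₀) = inj₁ (c′ , c′-solves)
    where
    c′ : Fin (suc j) → Bool
    -- One constraint determines the value at the eliminated vertex; the constraints added by `Via`
    -- make all others agree with it.
    c′ zero    = c u₀ xor τ
    c′ (suc u) = c u
    to-zero : ∀ {σ v} → S σ (suc v) zero → c v xor (c u₀ xor τ) ≡ σ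
    to-zero {σ} {v} s = xor-transpose (c u₀) (c v) τ σ
      (c-solves (inj₂ (τ , s₀ , subst (λ ρ → S ρ zero (suc v)) (sym (xor-cancelˡ τ σ)) (S-sym σ s))))
    c′-solves : ∀ {σ u v} → S σ u v → c′ u xor c′ v ≡ σ
    c′-solves {false} {zero}  {zero}  s = Bool.xor-same (c u₀ xor τ)
    c′-solves {true}  {zero}  {zero}  s = contradiction s ¬s
    c′-solves {σ}     {zero}  {suc v} s = trans (Bool.xor-comm (c u₀ xor τ) (c v)) (to-zero (S-sym σ s))
    c′-solves {σ}     {suc u} {zero}  s = to-zero s
    c′-solves {σ}     {suc u} {suc v} s = c-solves (inj₁ s)

odd : ℕ → Bool
odd zero    = false
odd (suc n) = not (odd n)

odd-+ : ∀ a b → odd (a + b) ≡ odd a xor odd b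
odd-+ zero    b = refl
odd-+ (suc a) b = trans (cong not (odd-+ a b)) (Bool.not-distribˡ-xor (odd a) (odd b))

odd⇒half : ∀ ℓ → odd ℓ ≡ true → ∃ λ k → ℓ ≡ suc (k + k)
odd⇒half ℓ eq with even-or-odd ℓ
... | inj₂ half = half
... | inj₁ (x , refl) = contradiction (trans (sym eq) (trans (odd-+ x x) (Bool.xor-same (odd x)))) λ ()

-- Each elimination at most doubles the length of the walks that justify the constraints, whence
-- 2^j. The odd walk found is lengthened to one fixed length, because its length determines the
-- number of coordinates later.
two-colouring : ∀ {j} {Q : Rel (Fin j) 0ℓ} → Binary.Decidable Q → Symmetric Q →
  (∃ λ (c : Fin j → Bool) → ∀ {u v} → Q u v → c u ≢ c v) ⊎
  (∃ λ u → Walk Q (suc (2 ^ j + 2 ^ j)) u u)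
two-colouring {j} {Q} Q? Q-sym
  with eliminate Link (λ {k} → compose {k}) (λ {k} → weaken {k}) j 0 id (λ σ u v → σ ≡ true × Q u v)
         (λ σ u v → (σ Bool.≟ true) ×-dec Q? u v) (λ σ (σ≡ , q) → σ≡ , Q-sym q)
         (λ (σ≡ , q) → 1 , ≤-refl , sym σ≡ , q ∷ [])
  where
  Link : ℕ → Bool → Fin j → Fin j → Set
  Link k σ u v = ∃ λ ℓ → ℓ ≤ 2 ^ k × odd ℓ ≡ σ × Walk Q ℓ u v
  compose : ∀ {k σ τ u v w} → Link k σ u v → Link k τ v w → Link (suc k) (σ xor τ) u w
  compose {k} (ℓ , ℓ≤ , refl , W) (ℓ′ , ℓ′≤ , refl , W′) =
    ℓ + ℓ′ , ≤-trans (+-mono-≤ ℓ≤ ℓ′≤) (≤-reflexive (cong (2 ^ k +_) (sym (+-identityʳ (2 ^ k))))) ,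
    odd-+ ℓ ℓ′ , W ++ʷ W′
  weaken : ∀ {k σ u v} → Link k σ u v → Link (suc k) σ u v
  weaken {k} (ℓ , ℓ≤ , σ≡ , W) = ℓ , ≤-trans ℓ≤ (m≤m+n (2 ^ k) _) , σ≡ , W
... | inj₁ (c , proper) = inj₁ (c , λ {u} q eq → contradiction
      (trans (sym (proper {σ = true} (refl , q))) (trans (cong (c u xor_) (sym eq)) (Bool.xor-same (c u)))) λ ())
... | inj₂ (u , ℓ , ℓ≤ , odd-ℓ , W) with odd⇒half ℓ odd-ℓ
...   | k , refl with m≤n⇒∃[o]m+o≡n (≤-trans (≤-trans (m≤m+n k k) (n≤1+n _)) (≤-trans ℓ≤ (≤-reflexive (cong (2 ^_) (+-identityʳ j)))))
...     | d , eq = inj₂ (u , subst (λ l → Walk Q l u u) (trans (arrange d k) (cong (λ z → suc (z + z)) eq)) (lengthen Q-sym W d))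
  where
  arrange : ∀ d k → d + d + suc (k + k) ≡ suc (k + d + (k + d))
  arrange = solve-∀

-- Degrees, and the cost of a two-colouring

∈-subsets : ∀ {n} (X : Subset n) → X ∈ subsets n
∈-subsets []            = here refl
∈-subsets (outside ∷ X) = ∈-++⁺ˡ (∈-map⁺ (outside ∷_) (∈-subsets X))
∈-subsets (inside  ∷ X) = ∈-++⁺ʳ _ (∈-map⁺ (inside ∷_) (∈-subsets X))

∑-lookup : ∀ {A : Set} (xs : List A) (f : A → ℕ) → ∑ (allFin (length xs)) (f ∘ List.lookup xs) ≡ ∑ xs f
∑-lookup xs f = trans (sym (∑-tabulate (List.lookup xs) f)) (cong (λ ys → ∑ ys f) (tabulate-lookup xs))

module _ {n : ℕ} (G : Graph n) where
  open Graph G using (_~_; _~?_)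

  private
    V = allFin n

  δ≤degree : ∀ v → δ G ≤ count (v ~?_) V
  δ≤degree v = ≤-trans
    (min≤v⁺ n (List.map (degree G) V) (inj₂ (Any.map (≤-reflexive ∘ sym) (∈-map⁺ (degree G) (∈-allFin v)))))
    (≤-reflexive (length-filter≡count (v ~?_) V))

  e≤pairs : e G ≤ ∑ V (λ u → count (u ~?_) V)
  e≤pairs = begin
    e G                                                        ≡⟨ length-filter≡count edge? (cartesianProduct V V) ⟩
    count edge? (cartesianProduct V V)                         ≡⟨ ∑-product _,_ V V _ ⟩
    ∑ V (λ u → ∑ V (λ v → ⟦ (u Fin.<? v) ×-dec (u ~? v) ⟧))
      ≤⟨ ∑-mono V (λ u → ∑-mono V λ v → ⟦⟧-mono ((u Fin.<? v) ×-dec (u ~? v)) (u ~? v) proj₂) ⟩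
    ∑ V (λ u → count (u ~?_) V)                                ∎
    where
    open ≤-Reasoning
    edge? = uncurry λ u v → (u Fin.<? v) ×-dec (u ~? v)

module _ {n : ℕ} (G : Graph n) where
  open Graph G using (_~_; _~?_)

  private
    V = allFin n

  e-induced : ∀ X → e (G [ X ]) ≤ ∑ V (λ u → ∑ V (λ v → ⟦ u ∈? X ⟧ * (⟦ v ∈? X ⟧ * ⟦ u ~? v ⟧)))
  e-induced X = begin
    e (G [ X ])
      ≤⟨ e≤pairs (G [ X ]) ⟩
    ∑ (allFin (length xs)) (λ i → ∑ (allFin (length xs)) (λ j → ⟦ List.lookup xs i ~? List.lookup xs j ⟧))
      ≡⟨ ∑-cong (allFin (length xs)) (λ i → ∑-lookup xs (λ v → ⟦ List.lookup xs i ~? v ⟧)) ⟩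
    ∑ (allFin (length xs)) (λ i → ∑ xs (λ v → ⟦ List.lookup xs i ~? v ⟧))
      ≡⟨ ∑-lookup xs (λ u → ∑ xs (λ v → ⟦ u ~? v ⟧)) ⟩
    ∑ xs (λ u → ∑ xs (λ v → ⟦ u ~? v ⟧))
      ≡⟨ ∑-filter (_∈? X) V _ ⟩
    ∑ V (λ u → ⟦ u ∈? X ⟧ * ∑ xs (λ v → ⟦ u ~? v ⟧))
      ≡⟨ ∑-cong V (λ u → trans (cong (⟦ u ∈? X ⟧ *_) (∑-filter (_∈? X) V _)) (sym (∑-*ˡ ⟦ u ∈? X ⟧ V _))) ⟩
    ∑ V (λ u → ∑ V (λ v → ⟦ u ∈? X ⟧ * (⟦ v ∈? X ⟧ * ⟦ u ~? v ⟧))) ∎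
    where
    open ≤-Reasoning
    xs = elements X

  γ₂≤cost : ∀ X → γ₂ G ≤ e (G [ X ]) + e (G [ ∁ X ])
  γ₂≤cost X = min≤v⁺ _ _ (inj₂ (Any.map (≤-reflexive ∘ sym) (∈-map⁺ _ (∈-subsets X))))

  -- The sum counts ordered pairs, hence every monochromatic edge twice; the factor is absorbed by
  -- the final constant.
  γ₂≤monochromatic : ∀ (χ : Fin n → Bool) →
    γ₂ G ≤ ∑ V (λ u → count (λ v → (χ u Bool.≟ χ v) ×-dec (u ~? v)) V)
  γ₂≤monochromatic χ = begin
    γ₂ G
      ≤⟨ γ₂≤cost X ⟩
    e (G [ X ]) + e (G [ ∁ X ])
      ≤⟨ +-mono-≤ (e-induced X) (e-induced (∁ X)) ⟩
    ∑ V (λ u → ∑ V (inX u)) + ∑ V (λ u → ∑ V (in∁X u))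
      ≡⟨ trans (∑-cong V (λ u → ∑-+ V (inX u) (in∁X u))) (∑-+ V _ _) ⟨
    ∑ V (λ u → ∑ V (λ v → inX u v + in∁X u v))
      ≤⟨ ∑-mono V (λ u → ∑-mono V λ v → pointwise u v) ⟩
    ∑ V (λ u → count (λ v → (χ u Bool.≟ χ v) ×-dec (u ~? v)) V) ∎
    where
    open ≤-Reasoning
    X = tabulate χ
    inX in∁X : Fin n → Fin n → ℕ
    inX  u v = ⟦ u ∈? X ⟧ * (⟦ v ∈? X ⟧ * ⟦ u ~? v ⟧)
    in∁X u v = ⟦ u ∈? ∁ X ⟧ * (⟦ v ∈? ∁ X ⟧ * ⟦ u ~? v ⟧)
    ∈⇒true : ∀ {u} → u ∈ˢ X → χ u ≡ true
    ∈⇒true {u} u∈ = trans (sym (lookup∘tabulate χ u)) ([]=⇒lookup u∈)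
    ∈∁⇒false : ∀ {u} → u ∈ˢ ∁ X → χ u ≡ false
    ∈∁⇒false {u} u∈ with χ u in eq
    ... | false = refl
    ... | true  = contradiction (lookup⇒[]= u X (trans (lookup∘tabulate χ u) eq)) (x∈∁p⇒x∉p u∈)
    same : ∀ {u v b} → χ u ≡ b → χ v ≡ b → ⟦ u ~? v ⟧ ≤ ⟦ (χ u Bool.≟ χ v) ×-dec (u ~? v) ⟧
    same {u} {v} χu χv = ⟦⟧-mono (u ~? v) ((χ u Bool.≟ χ v) ×-dec (u ~? v)) (trans χu (sym χv) ,_)
    drop-zeros : ∀ k → k + 0 + 0 ≡ k
    drop-zeros k = trans (+-identityʳ (k + 0)) (+-identityʳ k)
    pointwise : ∀ u v → inX u v + in∁X u v ≤ ⟦ (χ u Bool.≟ χ v) ×-dec (u ~? v) ⟧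
    pointwise u v with u ∈? X | u ∈? ∁ X
    ... | yes u∈ | yes u∉ = contradiction u∈ (x∈∁p⇒x∉p u∉)
    ... | no _   | no _   = z≤n
    pointwise u v | yes u∈ | no _ with v ∈? X
    ... | no _   = z≤n
    ... | yes v∈ = ≤-trans (≤-reflexive (trans (+-identityʳ _) (drop-zeros _))) (same (∈⇒true u∈) (∈⇒true v∈))
    pointwise u v | no _ | yes u∉ with v ∈? ∁ X
    ... | no _   = z≤n
    ... | yes v∉ = ≤-trans (≤-reflexive (drop-zeros _)) (same (∈∁⇒false u∉) (∈∁⇒false v∉))

∈-vecs : ∀ {A : Set} {xs : List A} → (∀ x → x ∈ xs) → ∀ {k} (v : Vec A k) → v ∈ vecs xs k
∈-vecs all []      = here refl
∈-vecs all (x ∷ v) = ∈-cartesianProductWith⁺ _∷_ (all x) (∈-vecs all v)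

-- Centres

module _ {n : ℕ} (G : Graph n) .{{_ : NonZero n}} (a : ℕ) .{{_ : NonZero a}}
         (linear-degree : ∀ v → n ≤ a * count (Graph._~?_ G v) (allFin n)) where
  open Graph G using (_~_; _~?_)

  private
    V = allFin n
    J c₁ : ℕ
    J = a + a
    c₁ = suc (J * J)

  codegree : Fin n → Fin n → ℕ
  codegree u v = count (λ w → (u ~? w) ×-dec (w ~? v)) V

  -- The threshold is a constant fraction of n. A threshold depending on D would let the number of
  -- centres, and with it the exponents, grow with D.
  Near : Fin n → Fin n → Set
  Near u v = n ≤ c₁ * codegree u v

  near? : ∀ u v → Dec (Near u v)
  near? u v = n ≤? c₁ * codegree u v

  Far : ∀ {k} → Vec (Fin n) k → Fin n → Set
  Far xs v = ∀ i → ¬ Near (lookup xs i) v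

  far? : ∀ {k} (xs : Vec (Fin n) k) v → Dec (Far xs v)
  far? xs v = Fin.all? λ i → ¬? (near? (lookup xs i) v)

  Scattered : ∀ {k} → Vec (Fin n) k → Set
  Scattered []       = ⊤
  Scattered (x ∷ xs) = Scattered xs × Far xs x

  private
    neighbours pairs : ∀ {k} → Vec (Fin n) k → Fin n → ℕ
    neighbours []       w = 0
    neighbours (x ∷ xs) w = ⟦ x ~? w ⟧ + neighbours xs w
    pairs []       w = 0
    pairs (x ∷ xs) w = ⟦ x ~? w ⟧ * neighbours xs w + pairs xs w

    -- The pointwise inequality m ≤ 1 + m(m - 1)/2; `pairs` counts pairs of entries that have `w` as
    -- a common neighbour.
    neighbours≤1+pairs : ∀ {k} (xs : Vec (Fin n) k) w → neighbours xs w ≤ 1 + pairs xs w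
    neighbours≤1+pairs []       w = z≤n
    neighbours≤1+pairs (x ∷ xs) w with x ~? w
    ... | no  _ = neighbours≤1+pairs xs w
    ... | yes _ = s≤s (≤-trans (≤-reflexive (sym (+-identityʳ _))) (m≤m+n _ (pairs xs w)))

    ∑-neighbours : ∀ {k} (xs : Vec (Fin n) k) → k * n ≤ a * ∑ V (neighbours xs)
    ∑-neighbours []       = z≤n
    ∑-neighbours {suc k} (x ∷ xs) = begin
      n + k * n                                          ≤⟨ +-mono-≤ (linear-degree x) (∑-neighbours xs) ⟩
      a * count (x ~?_) V + a * ∑ V (neighbours xs)      ≡⟨ *-distribˡ-+ a _ _ ⟨
      a * (count (x ~?_) V + ∑ V (neighbours xs))        ≡⟨ cong (a *_) (∑-+ V _ _) ⟨
      a * ∑ V (neighbours (x ∷ xs))                      ∎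
      where open ≤-Reasoning

    ∑-common : ∀ {k} (xs : Vec (Fin n) k) x → Far xs x →
               c₁ * ∑ V (λ w → ⟦ x ~? w ⟧ * neighbours xs w) ≤ k * n
    ∑-common []       x far = ≤-reflexive (trans
      (cong (c₁ *_) (trans (∑-cong V λ w → *-zeroʳ ⟦ x ~? w ⟧) (trans (∑-const V 0) (*-zeroʳ (length V))))) (*-zeroʳ c₁))
    ∑-common {suc k} (y ∷ xs) x far = begin
      c₁ * ∑ V (λ w → ⟦ x ~? w ⟧ * neighbours (y ∷ xs) w)
        ≡⟨ cong (c₁ *_) (trans (∑-cong V split) (∑-+ V (λ w → ⟦ (y ~? w) ×-dec (w ~? x) ⟧) (λ w → ⟦ x ~? w ⟧ * neighbours xs w))) ⟩
      c₁ * (codegree y x + ∑ V (λ w → ⟦ x ~? w ⟧ * neighbours xs w))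
        ≡⟨ *-distribˡ-+ c₁ (codegree y x) _ ⟩
      c₁ * codegree y x + c₁ * ∑ V (λ w → ⟦ x ~? w ⟧ * neighbours xs w)
        ≤⟨ +-mono-≤ (<⇒≤ (≰⇒> (far zero))) (∑-common xs x (far ∘ suc)) ⟩
      n + k * n ∎
      where
      open ≤-Reasoning
      split : ∀ w → ⟦ x ~? w ⟧ * neighbours (y ∷ xs) w ≡ ⟦ (y ~? w) ×-dec (w ~? x) ⟧ + ⟦ x ~? w ⟧ * neighbours xs w
      split w = trans (*-distribˡ-+ ⟦ x ~? w ⟧ ⟦ y ~? w ⟧ _) (cong (_+ ⟦ x ~? w ⟧ * neighbours xs w)
        (trans (*-comm ⟦ x ~? w ⟧ ⟦ y ~? w ⟧) (trans (cong (⟦ y ~? w ⟧ *_) (⟦⟧-cong (x ~? w) (w ~? x) (~-sym G) (~-sym G)))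
          (sym (⟦⟧-× (y ~? w) (w ~? x))))))

    ∑-pairs : ∀ {k} (xs : Vec (Fin n) k) → Scattered xs → c₁ * ∑ V (pairs xs) ≤ k * k * n
    ∑-pairs []                 _           = ≤-reflexive (trans (cong (c₁ *_) (trans (∑-const V 0) (*-zeroʳ (length V)))) (*-zeroʳ c₁))
    ∑-pairs {suc k} (x ∷ xs) (scattered , far) = begin
      c₁ * ∑ V (pairs (x ∷ xs))          ≡⟨ trans (cong (c₁ *_) (∑-+ V common (pairs xs))) (*-distribˡ-+ c₁ (∑ V common) (∑ V (pairs xs))) ⟩
      c₁ * ∑ V common + c₁ * ∑ V (pairs xs)
                                         ≤⟨ +-mono-≤ (∑-common xs x far) (∑-pairs xs scattered) ⟩
      k * n + k * k * n                  ≡⟨ *-distribʳ-+ n k (k * k) ⟨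
      (k + k * k) * n                    ≤⟨ *-monoˡ-≤ n (+-mono-≤ (n≤1+n k) (*-monoʳ-≤ k (n≤1+n k))) ⟩
      suc k * suc k * n                  ∎
      where
      open ≤-Reasoning
      common : Fin n → ℕ
      common w = ⟦ x ~? w ⟧ * neighbours xs w

  -- The origin of `J` and `c₁`: neighbourhoods of size n / a, 2a of them, have total size 2n, so
  -- the codegrees of pairs sum to at least n. Codegrees below n / c₁ would sum to at most J²n / c₁,
  -- which is less than n.
  ¬scattered : ∀ (xs : Vec (Fin n) J) → ¬ Scattered xs
  ¬scattered xs scattered = contradiction c₁n≤ (<⇒≱ (*-monoˡ-< n (n<1+n (J * J))))
    where
    open ≤-Reasoning
    n+n≤ : n + n ≤ n + ∑ V (pairs xs)
    n+n≤ = begin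
      n + n                           ≤⟨ *-cancelˡ-≤ a (≤-trans (≤-reflexive (distribute a n)) (∑-neighbours xs)) ⟩
      ∑ V (neighbours xs)             ≤⟨ ∑-mono V (neighbours≤1+pairs xs) ⟩
      ∑ V (λ w → 1 + pairs xs w)      ≡⟨ ∑-+ V (const 1) (pairs xs) ⟩
      ∑ V (const 1) + ∑ V (pairs xs)  ≡⟨ cong (_+ ∑ V (pairs xs)) (trans (sym (length≡∑1 V)) (allFin-length n)) ⟩
      n + ∑ V (pairs xs)              ∎
      where
      distribute : ∀ a n → a * (n + n) ≡ (a + a) * n
      distribute = solve-∀
    c₁n≤ : c₁ * n ≤ J * J * n
    c₁n≤ = ≤-trans (*-monoʳ-≤ c₁ (+-cancelˡ-≤ n _ _ n+n≤)) (∑-pairs xs scattered)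

  module _ (D : ℕ) .{{_ : NonZero D}} where

    Dominating : ∀ {k} → Vec (Fin n) k → Set
    Dominating xs = D * count (far? xs) V ≤ n

    dominating-∷ : ∀ {k} x (xs : Vec (Fin n) k) → Dominating xs → Dominating (x ∷ xs)
    dominating-∷ x xs = ≤-trans (*-monoʳ-≤ D (∑-mono V λ v → ⟦⟧-mono (far? (x ∷ xs) v) (far? xs v) (_∘ suc)))

    Centres : ℕ → Set₁
    Centres B = ∃ λ (P : Pattern n J) → Robust P B × (∀ xs → holds P xs → Dominating xs)

    private
      1≤2D : 1 ≤ 2 * D
      1≤2D = ≤-trans (>-nonZero⁻¹ D) (m≤m+n D _)

      -- Further centres can only shrink the set of far vertices, so arbitrary vertices may fill the
      -- tuple up.
      pad-centres : ∀ r {k} → r + k ≡ J → (P : Pattern n k) → ∀ B → Robust P B →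
                    (∀ xs → holds P xs → Dominating xs) → Centres B
      pad-centres zero    refl P B robust dominating = P , robust , dominating
      pad-centres (suc r) {k} r+k≡J P B robust dominating =
        pad-centres r (trans (+-suc r k) r+k≡J) (pad P) B (pad-robust P B robust)
          λ { (x ∷ xs) (p , _) → dominating-∷ x xs (dominating xs p) }

    -- A scattered tuple that does not dominate has at least n / D scattered extensions, and
    -- scattered tuples cannot reach length J.
    greedy : ∀ r {k} → r + k ≡ J → (P : Pattern n k) → (∀ xs → holds P xs → Scattered xs) →
             ∀ B → Robust P B → Centres (B * (2 * D * 2) ^ r)
    greedy zero refl P scattered B robust with nonempty P B robust
    ... | xs , p = contradiction (scattered xs p) (¬scattered xs)
    greedy (suc r) {k} r+k≡J P scattered B robust = choose
        (pigeonhole P (true ∷ false ∷ []) Case B cover robust)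
      where
      Case : Bool → Pattern n k
      Case true  = record { holds = Dominating ; holds? = λ xs → D * count (far? xs) V ≤? n }
      Case false = record { holds = λ xs → n ≤ D * count (far? xs) V ; holds? = λ xs → n ≤? D * count (far? xs) V }
      cover : ∀ xs → holds P xs → ∃ λ b → b ∈ true ∷ false ∷ [] × holds (Case b) xs
      cover xs _ with ≤-total (D * count (far? xs) V) n
      ... | inj₁ le = true , here refl , le
      ... | inj₂ ge = false , there (here refl) , ge
      grow : B * 2 ≤ B * (2 * D * 2) ^ suc r
      grow = *-monoʳ-≤ B (*-mono-≤ (*-monoˡ-≤ 2 1≤2D) (m^n>0 (2 * D * 2) {{>-nonZero (≤-trans (s≤s z≤n) (*-monoˡ-≤ 2 1≤2D))}} r))
      choose : (∃ λ b → Robust (P ∩ Case b) (B * 2)) → Centres (B * (2 * D * 2) ^ suc r)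
      choose (true , robust′) = pad-centres (suc r) r+k≡J (P ∩ Case true) (B * (2 * D * 2) ^ suc r)
        (robust-mono (P ∩ Case true) grow robust′) (λ xs → proj₂)
      choose (false , robust′) = subst Centres (*-assoc B (2 * D * 2) _)
        (greedy r (trans (+-suc r k) r+k≡J) P′
          (λ { (x ∷ xs) ((p , _) , far) → scattered xs p , far })
          (B * (2 * D * 2)) (robust-mono P′ bound (extend-robust (P ∩ Case false) Far′ D (B * 2) (λ xs → proj₂) robust′)))
        where
        Far′ : Fin n → Pattern n k
        Far′ x = record { holds = λ xs → Far xs x ; holds? = λ xs → far? xs x }
        P′ = (P ∩ Case false) ▹ Far′
        -- The case distinction costs a factor two and the new centre costs `D`; the remaining
        -- factor is slack.
        bound : B * 2 * D ≤ B * (2 * D * 2)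
        bound = ≤-trans (≤-reflexive (*-assoc B 2 D)) (*-monoʳ-≤ B (m≤m*n (2 * D) 2))

    centres : Centres ((2 * D * 2) ^ J)
    centres = subst Centres (*-identityˡ ((2 * D * 2) ^ J)) (greedy J (+-identityʳ J) anything start 1 ≤-refl)
      where
      start : ∀ (xs : Vec (Fin n) 0) → holds {n} {0} anything xs → Scattered xs
      start [] _ = tt

  -- Dense pairs of centres

  module _ (D : ℕ) .{{_ : NonZero D}} where

    private
      pair? : ∀ u u′ x y → Dec (x ~ y × Near u x × Near u′ y)
      pair? u u′ x y = (x ~? y) ×-dec (near? u x ×-dec near? u′ y)

    pairCount : Fin n → Fin n → ℕ
    pairCount u u′ = ∑ V (λ x → count (pair? u u′ x) V)

    -- Classes may overlap, and a centre may be dense to itself. Such a loop excludes a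
    -- two-colouring, and it is a closed walk of length one.
    Dense : Rel (Fin n) 0ℓ
    Dense u u′ = n * n ≤ D * pairCount u u′

    dense? : ∀ u u′ → Dec (Dense u u′)
    dense? u u′ = n * n ≤? D * pairCount u u′

    Dense-sym : Symmetric Dense
    Dense-sym {u} {u′} = subst (λ c → n * n ≤ D * c) (trans (∑-swap V V (λ x y → ⟦ pair? u u′ x y ⟧))
      (∑-cong V λ y → ∑-cong V λ x → ⟦⟧-cong (pair? u u′ x y) (pair? u′ u y x)
        (λ (x~y , p , q) → ~-sym G x~y , q , p) (λ (y~x , q , p) → ~-sym G y~x , p , q)))

    -- A monochromatic edge either meets one of the at most n / D far vertices, or joins classes of
    -- two centres of the same colour. The latter are not dense, and each of the J² pairs
    -- contributes at most n² / D.
    γ₂-small : ∀ (xs : Vec (Fin n) J) → Dominating D xs → (c : Fin J → Bool) →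
      (∀ {i i′} → Dense (lookup xs i) (lookup xs i′) → c i ≢ c i′) →
      D * γ₂ G ≤ (2 + J * J) * (n * n)
    γ₂-small xs dominating c proper = begin
      D * γ₂ G
        ≤⟨ *-monoʳ-≤ D (≤-trans (γ₂≤monochromatic G χ) (∑-mono V λ x → ∑-mono V λ y → pointwise x y)) ⟩
      D * ∑ V (λ x → ∑ V (λ y → ⟦ far? xs x ⟧ + ⟦ far? xs y ⟧ + ∑ I (λ i → ∑ I (λ i′ → sparse i i′ x y))))
        ≡⟨ cong (D *_) total ⟩
      D * (n * f + n * f + s)
        ≡⟨ distribute D n f s ⟩
      n * (D * f) + n * (D * f) + D * s
        ≤⟨ +-mono-≤ (+-mono-≤ (*-monoʳ-≤ n dominating) (*-monoʳ-≤ n dominating)) sparse-bound ⟩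
      n * n + n * n + J * J * (n * n)
        ≡⟨ collect (n * n) (J * J) ⟩
      (2 + J * J) * (n * n) ∎
      where
      open ≤-Reasoning
      I = allFin J
      f = count (far? xs) V
      distribute : ∀ D n f s → D * (n * f + n * f + s) ≡ n * (D * f) + n * (D * f) + D * s
      distribute = solve-∀
      collect : ∀ N j → N + N + j * N ≡ (2 + j) * N
      collect = solve-∀
      sparse : Fin J → Fin J → Fin n → Fin n → ℕ
      sparse i i′ x y = ⟦ ¬? (dense? (lookup xs i) (lookup xs i′)) ⟧ * ⟦ pair? (lookup xs i) (lookup xs i′) x y ⟧
      s = ∑ I (λ i → ∑ I (λ i′ → ∑ V (λ x → ∑ V (sparse i i′ x))))
      -- The search settles overlaps of classes. Far vertices get a default colour, and their edges
      -- are counted separately.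
      χ : Fin n → Bool
      χ v with Fin.any? (λ i → near? (lookup xs i) v)
      ... | yes (i , _) = c i
      ... | no  _       = false
      χ-spec : ∀ v → Far xs v ⊎ ∃ λ i → Near (lookup xs i) v × χ v ≡ c i
      χ-spec v with Fin.any? (λ i → near? (lookup xs i) v)
      ... | yes (i , near) = inj₂ (i , near , refl)
      ... | no  ¬near      = inj₁ λ i near → ¬near (i , near)
      pointwise : ∀ x y → ⟦ (χ x Bool.≟ χ y) ×-dec (x ~? y) ⟧ ≤
                  ⟦ far? xs x ⟧ + ⟦ far? xs y ⟧ + ∑ I (λ i → ∑ I (λ i′ → sparse i i′ x y))
      pointwise x y = ⟦⟧-≤ ((χ x Bool.≟ χ y) ×-dec (x ~? y)) case
        where
        case : χ x ≡ χ y × x ~ y → 1 ≤ _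
        case (χx≡χy , x~y) with χ-spec x | χ-spec y
        ... | inj₁ far | _ = ≤-trans (≤-reflexive (sym (⟦⟧-true (far? xs x) far))) (≤-trans (m≤m+n _ _) (m≤m+n _ _))
        ... | inj₂ _ | inj₁ far = ≤-trans (≤-reflexive (sym (⟦⟧-true (far? xs y) far))) (≤-trans (m≤n+m _ ⟦ far? xs x ⟧) (m≤m+n _ _))
        ... | inj₂ (i , near , χx≡) | inj₂ (i′ , near′ , χy≡) = begin
          1                                          ≡⟨ cong₂ _*_ (⟦⟧-true (¬? (dense? (lookup xs i) (lookup xs i′))) ¬dense)
                                                                  (⟦⟧-true (pair? (lookup xs i) (lookup xs i′) x y) (x~y , near , near′)) ⟨
          sparse i i′ x y                            ≤⟨ ∈-≤-∑ (λ i′ → sparse i i′ x y) (∈-allFin i′) ⟩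
          ∑ I (λ i′ → sparse i i′ x y)               ≤⟨ ∈-≤-∑ (λ i → ∑ I (λ i′ → sparse i i′ x y)) (∈-allFin i) ⟩
          ∑ I (λ i → ∑ I (λ i′ → sparse i i′ x y))   ≤⟨ m≤n+m _ (⟦ far? xs x ⟧ + ⟦ far? xs y ⟧) ⟩
          _                                          ∎
          where
          ¬dense : ¬ Dense (lookup xs i) (lookup xs i′)
          ¬dense dense = proper dense (trans (sym χx≡) (trans χx≡χy χy≡))
      sparse-bound : D * s ≤ J * J * (n * n)
      sparse-bound = begin
        D * s
          ≡⟨ trans (sym (∑-*ˡ D I _)) (∑-cong I λ i → sym (∑-*ˡ D I _)) ⟩
        ∑ I (λ i → ∑ I (λ i′ → D * ∑ V (λ x → ∑ V (sparse i i′ x))))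
          ≤⟨ ∑-mono I (λ i → ∑-mono I λ i′ → each i i′) ⟩
        ∑ I (λ _ → ∑ I (λ _ → n * n))
          ≡⟨ trans (∑-const I _) (cong₂ _*_ (allFin-length J) (trans (∑-const I _) (cong (_* (n * n)) (allFin-length J)))) ⟩
        J * (J * (n * n))
          ≡⟨ *-assoc J J (n * n) ⟨
        J * J * (n * n) ∎
        where
        each : ∀ i i′ → D * ∑ V (λ x → ∑ V (sparse i i′ x)) ≤ n * n
        each i i′ = ≤-trans (≤-reflexive (cong (D *_) factor)) (bound (dense? (lookup xs i) (lookup xs i′)))
          where
          d = ⟦ ¬? (dense? (lookup xs i) (lookup xs i′)) ⟧
          factor : ∑ V (λ x → ∑ V (sparse i i′ x)) ≡ d * pairCount (lookup xs i) (lookup xs i′)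
          factor = trans (∑-cong V λ x → ∑-*ˡ d V _) (∑-*ˡ d V _)
          bound : (dense? : Dec (Dense (lookup xs i) (lookup xs i′))) →
                  D * (⟦ ¬? dense? ⟧ * pairCount (lookup xs i) (lookup xs i′)) ≤ n * n
          bound (yes _)     = ≤-trans (≤-reflexive (*-zeroʳ D)) z≤n
          bound (no ¬dense) = ≤-trans (≤-reflexive (cong (D *_) (*-identityˡ _))) (<⇒≤ (≰⇒> ¬dense))
      total : ∑ V (λ x → ∑ V (λ y → ⟦ far? xs x ⟧ + ⟦ far? xs y ⟧ + ∑ I (λ i → ∑ I (λ i′ → sparse i i′ x y))))
              ≡ n * f + n * f + s
      total = begin-equality
        ∑ V (λ x → ∑ V (λ y → ⟦ far? xs x ⟧ + ⟦ far? xs y ⟧ + ∑ I (λ i → ∑ I (λ i′ → sparse i i′ x y))))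
          ≡⟨ ∑-cong V (λ x → trans (∑-+ V _ _) (cong (_+ rest x) (∑-+ V _ _))) ⟩
        ∑ V (λ x → ∑ V (λ y → ⟦ far? xs x ⟧) + f + ∑ V (λ y → ∑ I (λ i → ∑ I (λ i′ → sparse i i′ x y))))
          ≡⟨ trans (∑-+ V _ _) (cong (_+ ∑ V rest) (∑-+ V _ _)) ⟩
        ∑ V (λ x → ∑ V (λ y → ⟦ far? xs x ⟧)) + ∑ V (λ _ → f) + ∑ V (λ x → ∑ V (λ y → ∑ I (λ i → ∑ I (λ i′ → sparse i i′ x y))))
          ≡⟨ cong₂ _+_ (cong₂ _+_ first (constant f)) last ⟩
        n * f + n * f + s ∎
        where
        rest : Fin n → ℕ
        rest x = ∑ V (λ y → ∑ I (λ i → ∑ I (λ i′ → sparse i i′ x y)))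
        constant : ∀ k → ∑ V (λ _ → k) ≡ n * k
        constant k = trans (∑-const V k) (cong (_* k) (allFin-length n))
        first : ∑ V (λ x → ∑ V (λ y → ⟦ far? xs x ⟧)) ≡ n * f
        first = trans (∑-cong V λ x → constant ⟦ far? xs x ⟧) (∑-*ˡ n V _)
        last : ∑ V (λ x → ∑ V (λ y → ∑ I (λ i → ∑ I (λ i′ → sparse i i′ x y)))) ≡ s
        last = begin-equality
          ∑ V (λ x → ∑ V (λ y → ∑ I (λ i → ∑ I (λ i′ → sparse i i′ x y))))
            ≡⟨ ∑-cong V (λ x → trans (∑-swap V I _) (∑-cong I λ i → ∑-swap V I _)) ⟩
          ∑ V (λ x → ∑ I (λ i → ∑ I (λ i′ → ∑ V (sparse i i′ x))))
            ≡⟨ trans (∑-swap V I _) (∑-cong I λ i → ∑-swap V I _) ⟩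
          s ∎

    -- The walk visits the first centre, w, x, y, w′ and the second centre.
    link-cost : ℕ
    link-cost = D * c₁ * c₁

    -- An edge between the two classes is joined to each centre by a common neighbour: 2 + 1 + 2
    -- steps. The length is odd, so replacing every step between centres by a link preserves parity.
    -- The edge costs `D` and each common neighbour `c₁`.
    link : ∀ {b} (P : Pattern n b) {p q} → (∀ xs → holds P xs → Dense (lookup xs p) (lookup xs q)) →
      ∀ B → Robust P B → ∃ λ (P′ : Pattern n (4 + b)) → Robust P′ (B * link-cost) ×
        (∀ {w x y z xs} → holds P′ (w ∷ x ∷ y ∷ z ∷ xs) → holds P xs) ×
        Walk (Forced G P′) 5 (suc (suc (suc (suc p)))) (suc (suc (suc (suc q))))
    link {b} P {p} {q} dense B robust = P₃ ,
      subst (Robust P₃) (regroup B D c₁)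
        (extend-robust P₂ T₃ c₁ (B * D * c₁) (λ { (w ∷ x ∷ y ∷ xs) ((_ , _ , _ , near) , _) → near })
          (extend-robust P₁ T₂ c₁ (B * D) (λ { (x ∷ y ∷ xs) (_ , _ , near , _) → near })
            (extend₂-robust P T₁ D B dense robust))) ,
      (λ (((h , _) , _) , _) → h) ,
      -- New vertices go to the front, so coordinates 0 to 3 are w′, w, x and y.
      _∷_ {v = suc zero} (λ { (_ ∷ _ ∷ _ ∷ _ ∷ _) ((_ , p~w , _) , _) → p~w }) (
      _∷_ {v = suc (suc zero)} (λ { (_ ∷ _ ∷ _ ∷ _ ∷ _) ((_ , _ , w~x) , _) → w~x }) (
      _∷_ {v = suc (suc (suc zero))} (λ { (_ ∷ _ ∷ _ ∷ _ ∷ _) (((_ , x~y , _) , _) , _) → x~y }) (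
      _∷_ {v = zero} (λ { (_ ∷ _ ∷ _ ∷ _ ∷ _) (_ , _ , w′~y) → ~-sym G w′~y }) (
      (λ { (_ ∷ _ ∷ _ ∷ _ ∷ _) (_ , q~w′ , _) → ~-sym G q~w′ }) ∷ []))))
      where
      regroup : ∀ B D c → B * D * c * c ≡ B * (D * c * c)
      regroup = solve-∀
      T₁ : Fin n → Fin n → Pattern n b
      T₁ x y = record { holds  = λ xs → x ~ y × Near (lookup xs p) x × Near (lookup xs q) y
                      ; holds? = λ xs → pair? (lookup xs p) (lookup xs q) x y }
      P₁ = P ▹₂ T₁
      T₂ : Fin n → Pattern n (2 + b)
      T₂ w = record { holds  = λ xs → lookup xs (suc (suc p)) ~ w × w ~ lookup xs zero
                    ; holds? = λ xs → (lookup xs (suc (suc p)) ~? w) ×-dec (w ~? lookup xs zero) }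
      P₂ = P₁ ▹ T₂
      T₃ : Fin n → Pattern n (3 + b)
      T₃ w = record { holds  = λ xs → lookup xs (suc (suc (suc q))) ~ w × w ~ lookup xs (suc (suc zero))
                    ; holds? = λ xs → (lookup xs (suc (suc (suc q))) ~? w) ×-dec (w ~? lookup xs (suc (suc zero))) }
      P₃ = P₂ ▹ T₃

    Chained : ∀ {b} → Rel (Fin J) 0ℓ → Pattern n b → (r B : ℕ) → Fin J → Fin J → Set₁
    Chained {b} Q P r B i i′ =
      ∃ λ (P′ : Pattern n (r * 4 + b)) → Robust P′ (B * link-cost ^ r) × ∃ λ (ι : Fin J → Fin (r * 4 + b)) →
        (∀ {i i′} → Q i i′ → ∀ xs → holds P′ xs → Dense (lookup xs (ι i)) (lookup xs (ι i′))) ×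
        Walk (Forced G P′) (r * 5) (ι i) (ι i′)

    -- Every step gets four fresh vertices, even on a repeated edge. `ι` tracks the coordinates of
    -- the centres as they shift, and density is carried along for the links still to come.
    chain : ∀ {b} {Q : Rel (Fin J) 0ℓ} (P : Pattern n b) (ι : Fin J → Fin b) →
      (∀ {i i′} → Q i i′ → ∀ xs → holds P xs → Dense (lookup xs (ι i)) (lookup xs (ι i′))) →
      ∀ B → Robust P B → ∀ {r i i′} → Walk Q r i i′ → Chained Q P r B i i′
    chain P ι dense B robust [] = P , subst (Robust P) (sym (*-identityʳ B)) robust , ι , dense , []
    chain {b} {Q} P ι dense B robust {suc r} {i} {i′} (_∷_ {v = j} e W) = step (chain P ι dense B robust W)
      where
      regroup : ∀ B c l → B * c * l ≡ B * (l * c)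
      regroup = solve-∀
      step : Chained Q P r B j i′ → Chained Q P (suc r) B i i′
      step (P₁ , robust₁ , ι₁ , dense₁ , W₁) = attach (link P₁ (dense₁ e) (B * link-cost ^ r) robust₁)
        where
        attach : _ → Chained Q P (suc r) B i i′
        attach (P₂ , robust₂ , drop₄ , W₂) = P₂ , subst (Robust P₂) (regroup B (link-cost ^ r) link-cost) robust₂ ,
          (λ i → suc (suc (suc (suc (ι₁ i))))) ,
          (λ { q (_ ∷ _ ∷ _ ∷ _ ∷ xs) h → dense₁ q xs (drop₄ h) }) ,
          (W₂ ++ʷ mapʷ (λ p → suc (suc (suc (suc p)))) (λ { forced (_ ∷ _ ∷ _ ∷ _ ∷ xs) h → forced xs (drop₄ h) }) W₁)

-- Constants, and the dichotomy for a fixed D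

does-true : ∀ {A : Set} (a? : Dec A) → does a? ≡ true → A
does-true (yes a) _ = a

module Constants (h γ L : ℕ) .{{_ : NonZero L}} where

  g a J c₁ r K κ b E d κ₁ κ₂ : ℕ
  g  = suc γ
  a  = suc (g + g) * L
  J  = a + a
  c₁ = suc (J * J)
  r  = suc (2 ^ J + 2 ^ J)
  -- With five edges for each of the `r` steps, the walk through the links has length 2K + 1.
  K  = 5 * 2 ^ J + 2
  κ  = L * suc (K + K) * (suc (K + K) * suc (K + K)) + 1
  -- One vertex per round of shortening, four per link, and the centres.
  b  = K + (r * 4 + J)
  E  = h ^ b
  -- `robustness` has degree J + r in D, and the blow-up raises it to the power `E`.
  d  = (J + r) * E
  κ₁ = 4 ^ J * (2 ^ J) ^ J * (c₁ * c₁) ^ r * κ ^ K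
  κ₂ = κ₁ ^ E * (b * h * (b * h))

  -- The factors come from the greedy choice of centres, from fixing which pairs of centres are
  -- dense, from the links along an odd closed walk of centres, and from the shortening.
  robustness : ℕ → ℕ
  robustness D = (2 * D * 2) ^ J * (2 ^ J) ^ J * (D * c₁ * c₁) ^ r * κ ^ K

  robustness≡ : ∀ D → robustness D ≡ κ₁ * D ^ (J + r)
  robustness≡ D = begin
    (2 * D * 2) ^ J * (2 ^ J) ^ J * (D * c₁ * c₁) ^ r * κ ^ K
      ≡⟨ cong₂ (λ x y → x * (2 ^ J) ^ J * y * κ ^ K)
           (trans (cong (_^ J) (four D)) (^-distribʳ-* 4 D J))
           (trans (cong (_^ r) (*-assoc D c₁ c₁)) (^-distribʳ-* D (c₁ * c₁) r)) ⟩
    4 ^ J * D ^ J * (2 ^ J) ^ J * (D ^ r * (c₁ * c₁) ^ r) * κ ^ K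
      ≡⟨ arrange (4 ^ J) (D ^ J) ((2 ^ J) ^ J) (D ^ r) ((c₁ * c₁) ^ r) (κ ^ K) ⟩
    κ₁ * (D ^ J * D ^ r)
      ≡⟨ cong (κ₁ *_) (^-distribˡ-+-* D J r) ⟨
    κ₁ * D ^ (J + r) ∎
    where
    open ≡-Reasoning
    four : ∀ D → 2 * D * 2 ≡ 4 * D
    four = solve-∀
    arrange : ∀ u v w x y z → u * v * w * (x * y) * z ≡ u * w * y * z * (v * x)
    arrange = solve-∀

  -- The loss is κ₂ times D^d; the one spare power of D absorbs the constant.
  robustness-small : ∀ D n → κ₂ < D → D ^ suc d ≤ n → robustness D ^ E * (b * h * (b * h)) < n
  robustness-small D n κ₂<D D^≤n = begin-strict
    robustness D ^ E * s          ≡⟨ cong (λ x → x ^ E * s) (robustness≡ D) ⟩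
    (κ₁ * D ^ (J + r)) ^ E * s    ≡⟨ cong (_* s) (trans (^-distribʳ-* κ₁ (D ^ (J + r)) E) (cong (κ₁ ^ E *_) (^-*-assoc D (J + r) E))) ⟩
    κ₁ ^ E * D ^ d * s            ≡⟨ arrange (κ₁ ^ E) (D ^ d) s ⟩
    κ₂ * D ^ d                    <⟨ *-monoˡ-< (D ^ d) {{m^n≢0 D d {{>-nonZero (≤-<-trans z≤n κ₂<D)}}}} κ₂<D ⟩
    D * D ^ d                     ≤⟨ D^≤n ⟩
    n                             ∎
    where
    open ≤-Reasoning
    s = b * h * (b * h)
    arrange : ∀ x y z → x * y * z ≡ x * z * y
    arrange = solve-∀

  module _ (1≤γ : 1 ≤ γ) {n : ℕ} .{{_ : NonZero n}} (G : Graph n)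
           (large-degree : ∀ v → (2 * L + 1) * n ≤ a * count (Graph._~?_ G v) (allFin n)) where

    private
      instance
        a≢0 : NonZero a
        a≢0 = m*n≢0 (suc (g + g)) L
      linear-degree : ∀ v → n ≤ a * count (Graph._~?_ G v) (allFin n)
      linear-degree v = ≤-trans (≤-trans (≤-reflexive (sym (*-identityˡ n))) (*-monoˡ-≤ n (m≤n+m 1 (2 * L)))) (large-degree v)

    RobustOddCycle : ℕ → Set₁
    RobustOddCycle B = ∃ λ b′ → b′ ≡ b × ∃ λ (P : Pattern n b′) →
      Robust P B × ∃ λ p → Walk (Forced G P) (suc (γ + γ)) p p

    module _ (D : ℕ) .{{_ : NonZero D}} where

      private
        Dense′ : Vec (Fin n) J → Rel (Fin J) 0ℓ
        Dense′ xs i i′ = Dense G a linear-degree D (lookup xs i) (lookup xs i′)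

        dense′? : ∀ xs i i′ → Dec (Dense′ xs i i′)
        dense′? xs i i′ = dense? G a linear-degree D (lookup xs i) (lookup xs i′)

        -- The graph on the centres varies with the tuple, whereas `chain` needs the same pairs to
        -- be dense in all tuples. The matrix encodes this graph, so that `pigeonhole` can fix it.
        matrix : Vec (Fin n) J → Vec (Vec Bool J) J
        matrix xs = tabulate λ i → tabulate λ i′ → does (dense′? xs i i′)

        lookup-matrix : ∀ xs i i′ → lookup (lookup (matrix xs) i) i′ ≡ does (dense′? xs i i′)
        lookup-matrix xs i i′ = trans (cong (λ v → lookup v i′) (lookup∘tabulate _ i)) (lookup∘tabulate _ i′)

        dense-transfer : ∀ {xs ys} → matrix xs ≡ matrix ys → ∀ {i i′} → Dense′ xs i i′ → Dense′ ys i i′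
        dense-transfer {xs} {ys} eq {i} {i′} dense = does-true (dense′? ys i i′) (begin
          does (dense′? ys i i′)              ≡⟨ lookup-matrix ys i i′ ⟨
          lookup (lookup (matrix ys) i) i′    ≡⟨ cong (λ M → lookup (lookup M i) i′) eq ⟨
          lookup (lookup (matrix xs) i) i′    ≡⟨ lookup-matrix xs i i′ ⟩
          does (dense′? xs i i′)              ≡⟨ dec-true (dense′? xs i i′) dense ⟩
          true                                ∎)
          where open ≡-Reasoning

        bools : List Bool
        bools = true ∷ false ∷ []

        matrices : List (Vec (Vec Bool J) J)
        matrices = vecs (vecs bools J) J

        HasMatrix : Vec (Vec Bool J) J → Pattern n J
        HasMatrix M = record { holds = λ xs → M ≡ matrix xs ; holds? = λ xs → Vec.≡-dec (Vec.≡-dec Bool._≟_) M (matrix xs) }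

        has-matrix : ∀ xs → ∃ λ M → M ∈ matrices × holds (HasMatrix M) xs
        has-matrix xs = matrix xs , ∈-vecs (∈-vecs (λ { true → here refl ; false → there (here refl) })) (matrix xs) , refl

        B₀ B₁ : ℕ
        B₀ = (2 * D * 2) ^ J
        B₁ = B₀ * (2 ^ J) ^ J

        length-matrices : length matrices ≡ (2 ^ J) ^ J
        length-matrices = trans (length-vecs (vecs bools J) J) (cong (_^ J) (length-vecs bools J))

        walk-length : r * 5 ≡ suc (K + K)
        walk-length = arrange (2 ^ J)
          where
          arrange : ∀ x → suc (x + x) * 5 ≡ suc (5 * x + 2 + (5 * x + 2))
          arrange = solve-∀

      -- The two-colouring is attempted for a single tuple. If it fails, the odd walk of centres
      -- found there is valid for every tuple with the same matrix, and so it can be chained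
      -- robustly.
      dichotomy : D * γ₂ G ≤ (2 + J * J) * (n * n) ⊎ RobustOddCycle (robustness D)
      dichotomy = split (centres G a linear-degree D)
        where
        split : _ → _
        split (P , robust , dominating) = uniform (pigeonhole P matrices HasMatrix B₀ (λ xs _ → has-matrix xs) robust)
          where
          uniform : _ → _
          uniform (M , robust′) = conclude (nonempty P′ (B₀ * length matrices) robust′)
            where
            P′ = P ∩ HasMatrix M
            conclude : _ → _
            conclude (xs₀ , p₀ , M≡₀) = colour (two-colouring (dense′? xs₀) (Dense-sym G a linear-degree D))
              where
              extend : ∀ {u} → Chained G a linear-degree D (Dense′ xs₀) P′ r B₁ u u → RobustOddCycle (robustness D)
              extend {u} (P″ , robust″ , ι , _ , W) = shortenTo G {g} {L} large-degree K κ (m≤m+n _ 1) (m≤n+m 1 _) P″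
                (B₁ * (D * c₁ * c₁) ^ r) K refl 1≤γ robust″
                (subst (λ l → Walk (Forced G P″) l (ι u) (ι u)) walk-length W) (m≤n+m K γ) ≤-refl
              colour : _ → _
              colour (inj₁ (c , proper)) = inj₁ (γ₂-small G a linear-degree D xs₀ (dominating xs₀ p₀) c proper)
              colour (inj₂ (u , W)) = inj₂ (extend (chain G a linear-degree D P′ id
                (λ q xs (_ , M≡) → dense-transfer {xs₀} {xs} (trans (sym M≡₀) M≡) q) B₁
                (subst (λ l → Robust P′ (B₀ * l)) length-matrices robust′) W))

-- The choice of D

floor-root : ∀ q n → ∃ λ D → D ^ suc q ≤ n × n < suc D ^ suc q
floor-root q zero    = 0 , z≤n , m^n>0 1 (suc q)
floor-root q (suc n) with floor-root q n
... | D , D^≤n , n<D+1^ with suc n <? suc D ^ suc q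
...   | yes lt = D , ≤-trans D^≤n (n≤1+n n) , lt
...   | no ≮   = suc D , ≮⇒≥ ≮ , ≤-<-trans n<D+1^ (^-monoˡ-< (suc q) (n<1+n (suc D)))

module _ {h : ℕ} (H : Graph h) (γ L : ℕ) .{{_ : NonZero L}} where
  open Constants h γ L

  -- The lower bound on n in `floor-root` makes the embedding possible; the upper bound is passed on
  -- to turn 1 / D into a power of n.
  bipartite-up-to : 1 ≤ γ → ¬ ¬ (H ⟶ Cycle (suc (γ + γ))) → ∀ n → suc κ₂ ^ suc d ≤ n → (G : Graph n) → H -free G →
    (∀ v → (2 * L + 1) * n ≤ a * count (Graph._~?_ G v) (allFin n)) →
    ∃ λ D → 1 ≤ D × n < suc D ^ suc d × D * γ₂ G ≤ (2 + J * J) * (n * n)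
  bipartite-up-to 1≤γ hom n large G free large-degree = from-root (floor-root d n)
    where
    from-root : (∃ λ D → D ^ suc d ≤ n × n < suc D ^ suc d) →
                ∃ λ D → 1 ≤ D × n < suc D ^ suc d × D * γ₂ G ≤ (2 + J * J) * (n * n)
    from-root (D , D^≤n , n<) = D , ≤-trans (s≤s z≤n) κ₂<D , n< , bound (dichotomy 1≤γ G large-degree D)
      where
      κ₂<D : κ₂ < D
      κ₂<D = ≰⇒> λ D≤κ₂ → contradiction n< (≤⇒≯ (≤-trans (^-monoˡ-≤ (suc d) (s≤s D≤κ₂)) large))
      instance
        n≢0 : NonZero n
        n≢0 = >-nonZero (≤-trans (m^n>0 (suc κ₂) (suc d)) large)
        D≢0 : NonZero D
        D≢0 = >-nonZero (≤-<-trans z≤n κ₂<D)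
      bound : D * γ₂ G ≤ (2 + J * J) * (n * n) ⊎ RobustOddCycle 1≤γ G large-degree (robustness D) →
              D * γ₂ G ≤ (2 + J * J) * (n * n)
      bound (inj₁ small) = small
      bound (inj₂ (_ , refl , P , robust , _ , W)) = contradiction
        (λ f → embedding G H f P (robustness D) robust W (robustness-small D n κ₂<D D^≤n) free) hom

triangle-complete : ∀ i j → i ≢ j → Graph._~_ (Cycle 3) i j
triangle-complete = from-yes (Fin.all? λ i → Fin.all? λ j → ¬? (i Fin.≟ j) →-dec Graph._~?_ (Cycle 3) i j)

-- Minimality only refutes the absence of a homomorphism, which is enough to derive a contradiction.
-- For g = 2 it says nothing about the triangle, since smaller candidates are excluded by `2 ≤ j`;
-- there the three-colouring is the homomorphism.
¬¬-hom : ∀ {h} (H : Graph h) → Colourable H 3 → ∀ γ →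
         (∀ j → 2 ≤ j × ¬ (H ⟶ Cycle (suc (2 * j))) → 2 + γ ≤ j) → ¬ ¬ (H ⟶ Cycle (suc (suc γ + suc γ)))
¬¬-hom H (c , proper) zero    least ¬hom = ¬hom (c , λ u~v → triangle-complete _ _ (proper u~v))
¬¬-hom H _            (suc γ) least ¬hom = contradiction
  (least (2 + γ) (s≤s (s≤s z≤n) , subst (λ l → ¬ (H ⟶ Cycle (suc (2 + γ + l)))) (sym (+-identityʳ (2 + γ))) ¬hom)) (<⇒≱ (n<1+n _))

-- Rational numbers

open import Data.Integer as ℤ using (+_; -[1+_])

fromℕ-+ : ∀ m n → fromℕ (m + n) ≡ fromℕ m ℚ.+ fromℕ n
fromℕ-+ m n = ℚ.toℚᵘ-injective (ℚᵘ.≃-trans (ℚᵘ.*≡* (cong (ℤ._* + 1)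
  (trans (ℤ.pos-+ m n) (sym (cong₂ ℤ._+_ (ℤ.*-identityʳ (+ m)) (ℤ.*-identityʳ (+ n)))))))
  (ℚᵘ.≃-sym (ℚ.toℚᵘ-homo-+ (fromℕ m) (fromℕ n))))

fromℕ-* : ∀ m n → fromℕ (m * n) ≡ fromℕ m ℚ.* fromℕ n
fromℕ-* m n = ℚ.toℚᵘ-injective (ℚᵘ.≃-trans (ℚᵘ.*≡* (cong (ℤ._* + 1) (ℤ.pos-* m n)))
  (ℚᵘ.≃-sym (ℚ.toℚᵘ-homo-* (fromℕ m) (fromℕ n))))

fromℕ-^ : ∀ m k → fromℕ (m ^ k) ≡ fromℕ m ^ℚ k
fromℕ-^ m zero    = refl
fromℕ-^ m (suc k) = trans (fromℕ-* m (m ^ k)) (cong (fromℕ m ℚ.*_) (fromℕ-^ m k))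

fromℕ-mono-≤ : ∀ {m n} → m ≤ n → fromℕ m ℚ.≤ fromℕ n
fromℕ-mono-≤ m≤n = ℚ.*≤* (ℤ.*-monoʳ-≤-nonNeg (+ 1) (ℤ.+≤+ m≤n))

fromℕ-cancel-≤ : ∀ {m n} → fromℕ m ℚ.≤ fromℕ n → m ≤ n
fromℕ-cancel-≤ {m} {n} (ℚ.*≤* m≤n) = ℤ.drop‿+≤+ (subst₂ ℤ._≤_ (ℤ.*-identityʳ (+ m)) (ℤ.*-identityʳ (+ n)) m≤n)

/-*-cancel : ∀ k m → (+ k / suc m) ℚ.* fromℕ (suc m) ≡ fromℕ k
/-*-cancel k m = ℚ.toℚᵘ-injective (ℚᵘ.≃-trans (ℚ.toℚᵘ-homo-* (+ k / suc m) (fromℕ (suc m)))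
  (ℚᵘ.≃-trans (ℚᵘ.*-congʳ (ℚ.toℚᵘ-fromℚᵘ (ℚᵘ.mkℚᵘ (+ k) m)))
  (ℚᵘ.*≡* (trans (ℤ.*-identityʳ (+ k ℤ.* + suc m)) (cong (λ l → + k ℤ.* + l) (sym (*-identityʳ (suc m))))))))

-- A positive rational has numerator at least one, so its denominator can serve as `L`.
1≤ε*denominator : ∀ ε → 0ℚ ℚ.< ε → 1ℚ ℚ.≤ ε ℚ.* fromℕ (↧ₙ ε)
1≤ε*denominator ε@(mkℚ (+ suc p) d-1 _) _ = ℚ.toℚᵘ-cancel-≤
  (ℚᵘ.≤-respʳ-≃ (ℚᵘ.≃-sym (ℚ.toℚᵘ-homo-* ε (fromℕ (suc d-1)))) (ℚᵘ.*≤* (subst₂ ℤ._≤_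
    (trans (cong +_ (sym (*-identityʳ (suc d-1)))) (sym (ℤ.*-identityˡ (+ (suc d-1 * 1)))))
    (trans (ℤ.pos-* (suc p) (suc d-1)) (sym (ℤ.*-identityʳ (+ suc p ℤ.* + suc d-1))))
    (ℤ.+≤+ (m≤m+n (suc d-1) (p * suc d-1))))))
1≤ε*denominator (mkℚ (+ zero) _ _)   (ℚ.*<* (ℤ.+<+ ()))
1≤ε*denominator (mkℚ -[1+ _ ] _ _)   (ℚ.*<* ())

degree-in-ℕ : ∀ g ε n δ → 0ℚ ℚ.< ε → ((+ 2 / suc (2 * g)) ℚ.+ ε) ℚ.* fromℕ n ℚ.≤ fromℕ δ →
              (2 * ↧ₙ ε + 1) * n ≤ suc (2 * g) * ↧ₙ ε * δ
degree-in-ℕ g ε n δ 0<ε δ-large = fromℕ-cancel-≤ (begin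
  fromℕ ((2 * L + 1) * n)                   ≡⟨ trans (fromℕ-* (2 * L + 1) n) (cong (ℚ._* N)
                                                 (trans (fromℕ-+ (2 * L) 1) (cong (ℚ._+ 1ℚ) (fromℕ-* 2 L)))) ⟩
  (fromℕ 2 ℚ.* ℓ ℚ.+ 1ℚ) ℚ.* N              ≤⟨ ℚ.*-monoʳ-≤-nonNeg N (ℚ.+-monoʳ-≤ (fromℕ 2 ℚ.* ℓ) 1≤Sεℓ) ⟩
  (fromℕ 2 ℚ.* ℓ ℚ.+ S ℚ.* (ε ℚ.* ℓ)) ℚ.* N ≡⟨ cong (λ x → (x ℚ.* ℓ ℚ.+ S ℚ.* (ε ℚ.* ℓ)) ℚ.* N) (/-*-cancel 2 (2 * g)) ⟨
  (t ℚ.* S ℚ.* ℓ ℚ.+ S ℚ.* (ε ℚ.* ℓ)) ℚ.* N ≡⟨ arrange t S ℓ ε N ⟩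
  (S ℚ.* ℓ) ℚ.* ((t ℚ.+ ε) ℚ.* N)           ≡⟨ cong (ℚ._* ((t ℚ.+ ε) ℚ.* N)) (fromℕ-* s L) ⟨
  fromℕ (s * L) ℚ.* ((t ℚ.+ ε) ℚ.* N)       ≤⟨ ℚ.*-monoˡ-≤-nonNeg (fromℕ (s * L)) δ-large ⟩
  fromℕ (s * L) ℚ.* fromℕ δ                 ≡⟨ fromℕ-* (s * L) δ ⟨
  fromℕ (s * L * δ)                         ∎)
  where
  open ℚ.≤-Reasoning
  L = ↧ₙ ε
  s = suc (2 * g)
  t = + 2 / s
  ℓ = fromℕ L
  S = fromℕ s
  N = fromℕ n
  1≤Sεℓ : 1ℚ ℚ.≤ S ℚ.* (ε ℚ.* ℓ)
  1≤Sεℓ = begin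
    1ℚ                 ≤⟨ fromℕ-mono-≤ {1} {s} (s≤s z≤n) ⟩
    S                  ≡⟨ ℚ.*-identityʳ S ⟨
    S ℚ.* 1ℚ           ≤⟨ ℚ.*-monoˡ-≤-nonNeg S (1≤ε*denominator ε 0<ε) ⟩
    S ℚ.* (ε ℚ.* ℓ)    ∎
  arrange : ∀ t S ℓ ε N → (t ℚ.* S ℚ.* ℓ ℚ.+ S ℚ.* (ε ℚ.* ℓ)) ℚ.* N ≡ (S ℚ.* ℓ) ℚ.* ((t ℚ.+ ε) ℚ.* N)
  arrange = solve 5 (λ t S ℓ ε N → (t :* S :* ℓ :+ S :* (ε :* ℓ)) :* N := (S :* ℓ) :* ((t :+ ε) :* N)) refl
    where open ℚ.+-*-Solver

-- Since D + 1 ≤ 2D, n is below the power of 2D; this is where the factor 2 in the final constant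
-- comes from.
root-bound : ∀ {x D n c} q → 1 ≤ D → n < suc D ^ suc q → D * x ≤ c * (n * n) →
             x ^ suc q * n ≤ (2 * c) ^ suc q * n ^ (2 * suc q)
root-bound {x} {D} {n} {c} q 1≤D n< Dx≤ = begin
  x ^ k * n                         ≤⟨ *-monoʳ-≤ (x ^ k) (≤-trans (<⇒≤ n<) (^-monoˡ-≤ k suc-D≤)) ⟩
  x ^ k * (2 * D) ^ k               ≡⟨ ^-distribʳ-* x (2 * D) k ⟨
  (x * (2 * D)) ^ k                 ≡⟨ cong (_^ k) (arrange x D) ⟩
  (2 * (D * x)) ^ k                 ≤⟨ ^-monoˡ-≤ k (*-monoʳ-≤ 2 Dx≤) ⟩
  (2 * (c * (n * n))) ^ k           ≡⟨ cong (_^ k) (arrange′ c n) ⟩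
  (2 * c * n ^ 2) ^ k               ≡⟨ ^-distribʳ-* (2 * c) (n ^ 2) k ⟩
  (2 * c) ^ k * (n ^ 2) ^ k         ≡⟨ cong ((2 * c) ^ k *_) (^-*-assoc n 2 k) ⟩
  (2 * c) ^ k * n ^ (2 * k)         ∎
  where
  open ≤-Reasoning
  k = suc q
  suc-D≤ : suc D ≤ 2 * D
  suc-D≤ = ≤-trans (+-monoˡ-≤ D 1≤D) (≤-reflexive (cong (λ m → D + m) (sym (+-identityʳ D))))
  arrange : ∀ x D → x * (2 * D) ≡ 2 * (D * x)
  arrange = solve-∀
  arrange′ : ∀ c n → 2 * (c * (n * n)) ≡ 2 * c * (n * (n * 1))
  arrange′ = solve-∀

-- Given in lowest terms, so that numerator and denominator compute and `_≤_·_^2-_` unfolds to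
-- explicit powers.
1/suc : ℕ → ℚ
1/suc q = mkℚ (+ 1) q (1-coprimeTo (suc q))

power-bound : ∀ {x n c} q → x ^ suc q * n ≤ c ^ suc q * n ^ (2 * suc q) → x ≤ fromℕ c · n ^2- 1/suc q
power-bound {x} {n} {c} q le = subst₂ ℚ._≤_
  (trans (cong (λ m → fromℕ (x ^ suc q * m)) (sym (*-identityʳ n))) (split x (suc q) 1))
  (split c (suc q) (2 * suc q)) (fromℕ-mono-≤ le)
  where
  split : ∀ y k l → fromℕ (y ^ k * n ^ l) ≡ fromℕ y ^ℚ k ℚ.* fromℕ n ^ℚ l
  split y k l = trans (fromℕ-* (y ^ k) (n ^ l)) (cong₂ ℚ._*_ (fromℕ-^ y k) (fromℕ-^ n l))

theorem1p2 : ∀ {h} (H : Graph h) → HasChromaticNumber H 3 →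
    ∀ g → IsLeast (λ k → 2 ≤ k × ¬ (H ⟶ Cycle (suc (2 * k)))) g →
    ∀ (ε : ℚ) → 0ℚ ℚ.< ε →
    ∃ λ (C : ℚ) → ∃ λ (ρ : ℚ) → ∃ λ (n₀ : ℕ) →
    0ℚ ℚ.< C × 0ℚ ℚ.< ρ ×
    (∀ n → n₀ ≤ n → (G : Graph n) → H -free G →
    (+ 2 / suc (2 * g) ℚ.+ ε) ℚ.* fromℕ n ℚ.≤ fromℕ (δ G) →
    γ₂ G ≤ C · n ^2- ρ)
theorem1p2 H _               0             ((() , _) , _)
theorem1p2 H _               1             ((s≤s () , _) , _)
theorem1p2 {h} H (colourable , _) (suc (suc γ)) (_ , least) ε 0<ε =
  -- The exponent is the reciprocal of the root taken of n, and the threshold ensures that this root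
  -- exceeds `κ₂`.
  fromℕ (2 * (2 + J * J)) , 1/suc d , suc κ₂ ^ suc d ,
  ℚ.*<* (ℤ.+<+ (s≤s z≤n)) , ℚ.*<* (ℤ.+<+ (s≤s z≤n)) , main
  where
  open Constants h (suc γ) (↧ₙ ε)
  main : ∀ n → suc κ₂ ^ suc d ≤ n → (G : Graph n) → H -free G →
    (+ 2 / suc (2 * g) ℚ.+ ε) ℚ.* fromℕ n ℚ.≤ fromℕ (δ G) → γ₂ G ≤ fromℕ (2 * (2 + J * J)) · n ^2- 1/suc d
  main n n₀≤n G free δ-large = conclude
    (bipartite-up-to H (suc γ) (↧ₙ ε) (s≤s z≤n) (¬¬-hom H colourable γ least) n n₀≤n G free large-degree)
    where
    large-degree : ∀ v → (2 * ↧ₙ ε + 1) * n ≤ a * count (Graph._~?_ G v) (allFin n)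
    large-degree v = ≤-trans (degree-in-ℕ g ε n (δ G) 0<ε δ-large)
      (*-mono-≤ (≤-reflexive (cong (λ k → suc (g + k) * ↧ₙ ε) (+-identityʳ g))) (δ≤degree G v))
    conclude : _ → γ₂ G ≤ fromℕ (2 * (2 + J * J)) · n ^2- 1/suc d
    conclude (D , 1≤D , n< , Dγ≤) = power-bound d (root-bound {D = D} {c = 2 + J * J} d 1≤D n< Dγ≤)
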